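{- The following six statements are equivalent to one another (that is, either all of them are true or all of them are false). (1) Every digraph $D$ has a vertex $v$ for which $d^{+}(v) \leq d^{++}(v)$. (2) Every digraph $D$ satisfies $S_D \mathbf{1} \not> \mathbf{0}$. (3) Every digraph $D$ and every weight vector $\mathbf{w}$ on $D$ satisfy $S_D\mathbf{w} \not> \mathbf{0}$. (4) For every digraph $D$ there is a non-zero weight vector $\mathbf{w}$ on $D$ with $S_D\mathbf{w} \leq \mathbf{0}$. (5) For every digraph $D$ there is a real vector $\mathbf{v}$, indexed by $V(D)$ (not necessarily a weight vector), with at least one positive component and such that $S_D\mathbf{v} \leq \mathbf{0}$. (6) There is no digraph $D$ such that $S_D$ is invertible and $S_D^{ -1} \geq \mathbf{0}$.
   Context: A digraph is a finite directed graph with at least one vertex whose underlying graph is simple, i.e. it has no loops and there is at most one arc between any two distinct vertices (in particular no pair of opposite arcs). For vertices $u,v$ of a digraph $D$, $d(u,v)$ is the length of a shortest directed path from $u$ to $v$ in $D$ (with $d(u,v)=\infty$ if there is none). Put $d^{+}(v)=|\{u\in V(D) : d(v,u)=1\}|$ and $d^{++}(v)=|\{u\in V(D) : d(v,u)=2\}|$. If $V(D)=\{v_1,\dots,v_n\}$, the second-neighborhood matrix $S_D=(s_{ij})$ is the $n\times n$ real matrix with $s_{ij}=1$ if $d(v_i,v_j)=1$, $s_{ij}=-1$ if $d(v_i,v_j)=2$, and $s_{ij}=0$ otherwise. A weight vector on $D$ is a real vector $\mathbf{w}$ indexed by $V(D)$ with all components in $[0,\infty)$. $\mathbf{0}$ and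 $\mathbf{1}$ denote the vector or matrix of all zeros, respectively all ones, of the appropriate dimensions. For vectors (or matrices), a relation such as $\mathbf{u}\leq\mathbf{v}$, $\mathbf{u}\ge\mathbf{v}$ or $\mathbf{u}>\mathbf{v}$ means that the relation holds in every component; the negated relation $\mathbf{u}\not>\mathbf{v}$ means that $u_i\leq v_i$ for at least one $i$. -}

module Defs where

open import Data.Bool using (Bool; T; T?; if_then_else_)
open import Data.Bool.Properties using (T-irrelevant)
open import Data.Fin using (Fin)
import Data.Fin.Properties as Fin
open import Data.List using (List; []; _∷_; length; filter; allFin)
open import Data.List.Relation.Unary.Unique.Propositional using (Unique)
import Data.List.Relation.Unary.Unique.DecPropositional as DecUnique
open import Data.Nat as ℕ using (ℕ; zero; suc)
import Data.Nat.Properties as ℕ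
open import Data.Product using (Σ; Σ-syntax; ∃; ∃-syntax; _×_; _,_)
open import Data.Rational as ℚ using (ℚ; 0ℚ; 1ℚ; ½; ∣_∣; Positive; positive)
import Data.Rational.Properties as ℚ
open import Data.Rational.Solver using (module +-*-Solver)
open import Data.Vec as Vec using (Vec)
open import Data.Vec.Functional using (Vector; foldr)
open import Relation.Binary.PropositionalEquality using (_≡_; refl; sym; cong; subst)
open import Relation.Nullary using (¬_; Dec; yes; no; does)
open import Relation.Nullary.Decidable using (map′; _×-dec_; ¬?)

-- Cauchy sequences of rationals.  There is no quotient; equality of reals is
-- the relation _≈ᴿ_.
record ℝ : Set where
  constructor mkℝ
  field
    seq    : ℕ → ℚ
    cauchy : ∀ ε → 0ℚ ℚ.< ε →
             ∃[ N ] (∀ m n → N ℕ.≤ m → N ℕ.≤ n → ∣ seq m ℚ.- seq n ∣ ℚ.< ε)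

open ℝ public

Eventually : (ℕ → Set) → Set
Eventually P = ∃[ N ] (∀ n → N ℕ.≤ n → P n)

infix 4 _≈ᴿ_ _<ᴿ_ _≤ᴿ_

_≈ᴿ_ : ℝ → ℝ → Set
x ≈ᴿ y = ∀ ε → 0ℚ ℚ.< ε → Eventually (λ n → ∣ seq x n ℚ.- seq y n ∣ ℚ.< ε)

_<ᴿ_ : ℝ → ℝ → Set
x <ᴿ y = ∃[ ε ] (0ℚ ℚ.< ε × Eventually (λ n → seq x n ℚ.+ ε ℚ.< seq y n))

_≤ᴿ_ : ℝ → ℝ → Set
x ≤ᴿ y = ∀ ε → 0ℚ ℚ.< ε → Eventually (λ n → seq x n ℚ.< seq y n ℚ.+ ε)

fromℚ : ℚ → ℝ
fromℚ q .seq _        = q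
fromℚ q .cauchy ε 0<ε = 0 , λ _ _ _ _ → subst (ℚ._< ε) (sym (cong ∣_∣ (ℚ.+-inverseʳ q))) 0<ε

0ᴿ 1ᴿ : ℝ
0ᴿ = fromℚ 0ℚ
1ᴿ = fromℚ 1ℚ

½ε+½ε≡ε : ∀ ε → ½ ℚ.* ε ℚ.+ ½ ℚ.* ε ≡ ε
½ε+½ε≡ε = solve 1 (λ e → con ½ :* e :+ con ½ :* e := e) refl
  where open +-*-Solver

0<½ε : ∀ {ε} → 0ℚ ℚ.< ε → 0ℚ ℚ.< ½ ℚ.* ε
0<½ε {ε} 0<ε = ℚ.positive⁻¹ (½ ℚ.* ε) {{ℚ.pos*pos⇒pos ½ ε {{positive 0<ε}}}}

infixl 6 _+ᴿ_
infixl 7 _*ᴿ_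
infix  8 -ᴿ_

-ᴿ_ : ℝ → ℝ
(-ᴿ x) .seq n = ℚ.- seq x n
(-ᴿ x) .cauchy ε 0<ε with N , close ← cauchy x ε 0<ε =
  N , λ m n N≤m N≤n → subst (ℚ._< ε) (sym (eq (seq x m) (seq x n))) (close m n N≤m N≤n)
  where
  open ℚ.≤-Reasoning
  open +-*-Solver
  eq : ∀ p q → ∣ ℚ.- p ℚ.- ℚ.- q ∣ ≡ ∣ p ℚ.- q ∣
  eq p q = begin-equality
    ∣ ℚ.- p ℚ.- ℚ.- q ∣  ≡⟨ cong ∣_∣ (solve 2 (λ a b → :- a :- (:- b) := :- (a :- b)) refl p q) ⟩
    ∣ ℚ.- (p ℚ.- q) ∣    ≡⟨ ℚ.∣-p∣≡∣p∣ (p ℚ.- q) ⟩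
    ∣ p ℚ.- q ∣          ∎

_+ᴿ_ : ℝ → ℝ → ℝ
(x +ᴿ y) .seq n = seq x n ℚ.+ seq y n
(x +ᴿ y) .cauchy ε 0<ε
  with M , closeˣ ← cauchy x (½ ℚ.* ε) (0<½ε 0<ε)
     | N , closeʸ ← cauchy y (½ ℚ.* ε) (0<½ε 0<ε) =
  M ℕ.⊔ N , λ m n ≤m ≤n →
    bound (seq x m) (seq x n) (seq y m) (seq y n)
      (closeˣ m n (ℕ.m⊔n≤o⇒m≤o M N ≤m) (ℕ.m⊔n≤o⇒m≤o M N ≤n))
      (closeʸ m n (ℕ.m⊔n≤o⇒n≤o M N ≤m) (ℕ.m⊔n≤o⇒n≤o M N ≤n))
  where
  open ℚ.≤-Reasoning
  open +-*-Solver
  bound : ∀ p p′ q q′ → ∣ p ℚ.- p′ ∣ ℚ.< ½ ℚ.* ε → ∣ q ℚ.- q′ ∣ ℚ.< ½ ℚ.* ε →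
          ∣ (p ℚ.+ q) ℚ.- (p′ ℚ.+ q′) ∣ ℚ.< ε
  bound p p′ q q′ h k = begin-strict
    ∣ (p ℚ.+ q) ℚ.- (p′ ℚ.+ q′) ∣     ≡⟨ cong ∣_∣ (solve 4 (λ a a′ b b′ →
                                            (a :+ b) :- (a′ :+ b′) := (a :- a′) :+ (b :- b′))
                                            refl p p′ q q′) ⟩
    ∣ (p ℚ.- p′) ℚ.+ (q ℚ.- q′) ∣     ≤⟨ ℚ.∣p+q∣≤∣p∣+∣q∣ (p ℚ.- p′) (q ℚ.- q′) ⟩
    ∣ p ℚ.- p′ ∣ ℚ.+ ∣ q ℚ.- q′ ∣     <⟨ ℚ.+-mono-< h k ⟩
    ½ ℚ.* ε ℚ.+ ½ ℚ.* ε               ≡⟨ ½ε+½ε≡ε ε ⟩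
    ε                                 ∎

bounded : ∀ x → ∃[ B ] (Positive B × Eventually (λ n → ∣ seq x n ∣ ℚ.≤ B))
bounded x with N , close ← cauchy x 1ℚ (ℚ.positive⁻¹ 1ℚ) =
  1ℚ ℚ.+ c , ℚ.pos+nonNeg⇒pos 1ℚ c {{ℚ.∣-∣-nonNeg (seq x N)}} , N , λ n N≤n → begin
    ∣ seq x n ∣                            ≡⟨ cong ∣_∣ (solve 2 (λ a b → a := (a :- b) :+ b)
                                                refl (seq x n) (seq x N)) ⟩
    ∣ (seq x n ℚ.- seq x N) ℚ.+ seq x N ∣  ≤⟨ ℚ.∣p+q∣≤∣p∣+∣q∣ (seq x n ℚ.- seq x N) (seq x N) ⟩
    ∣ seq x n ℚ.- seq x N ∣ ℚ.+ c          ≤⟨ ℚ.+-monoˡ-≤ c (ℚ.<⇒≤ (close n N N≤n ℕ.≤-refl)) ⟩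
    1ℚ ℚ.+ c                               ∎
  where
  open ℚ.≤-Reasoning
  open +-*-Solver
  c = ∣ seq x N ∣

scale : ∀ B → Positive B → ∀ ε → 0ℚ ℚ.< ε → ∃[ δ ] (0ℚ ℚ.< δ × B ℚ.* δ ≡ ε)
scale B B>0 ε ε>0 = B⁻¹ ℚ.* ε , ℚ.positive⁻¹ (B⁻¹ ℚ.* ε) {{δ>0}} , eq
  where
  open ℚ.≤-Reasoning
  instance
    _ = B>0
    _ = ℚ.pos⇒nonZero B
    _ = positive ε>0
  B⁻¹ = ℚ.1/ B
  δ>0 : Positive (B⁻¹ ℚ.* ε)
  δ>0 = ℚ.pos*pos⇒pos B⁻¹ {{ℚ.1/pos⇒pos B}} ε
  eq : B ℚ.* (B⁻¹ ℚ.* ε) ≡ ε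
  eq = begin-equality
    B ℚ.* (B⁻¹ ℚ.* ε)  ≡⟨ ℚ.*-assoc B B⁻¹ ε ⟨
    B ℚ.* B⁻¹ ℚ.* ε    ≡⟨ cong (ℚ._* ε) (ℚ.*-inverseʳ B) ⟩
    1ℚ ℚ.* ε           ≡⟨ ℚ.*-identityˡ ε ⟩
    ε                  ∎

_*ᴿ_ : ℝ → ℝ → ℝ
(x *ᴿ y) .seq n = seq x n ℚ.* seq y n
(x *ᴿ y) .cauchy ε 0<ε =
  let A , A>0 , K , ∣x∣≤A = bounded x
      B , B>0 , L , ∣y∣≤B = bounded y
      α , α>0 , Aα≡ = scale A A>0 (½ ℚ.* ε) (0<½ε 0<ε)
      β , β>0 , Bβ≡ = scale B B>0 (½ ℚ.* ε) (0<½ε 0<ε)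
      M , closeˣ = cauchy x β β>0
      N , closeʸ = cauchy y α α>0
  in (K ℕ.⊔ L) ℕ.⊔ (M ℕ.⊔ N) , λ m n ≤m ≤n →
    let KL≤m = ℕ.m⊔n≤o⇒m≤o (K ℕ.⊔ L) (M ℕ.⊔ N) ≤m
        KL≤n = ℕ.m⊔n≤o⇒m≤o (K ℕ.⊔ L) (M ℕ.⊔ N) ≤n
        MN≤m = ℕ.m⊔n≤o⇒n≤o (K ℕ.⊔ L) (M ℕ.⊔ N) ≤m
        MN≤n = ℕ.m⊔n≤o⇒n≤o (K ℕ.⊔ L) (M ℕ.⊔ N) ≤n
    in bound (seq x m) (seq x n) (seq y m) (seq y n)
         (∣x∣≤A m (ℕ.m⊔n≤o⇒m≤o K L KL≤m))
         (∣y∣≤B n (ℕ.m⊔n≤o⇒n≤o K L KL≤n))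
         (closeˣ m n (ℕ.m⊔n≤o⇒m≤o M N MN≤m) (ℕ.m⊔n≤o⇒m≤o M N MN≤n))
         (closeʸ m n (ℕ.m⊔n≤o⇒n≤o M N MN≤m) (ℕ.m⊔n≤o⇒n≤o M N MN≤n))
         A>0 B>0 Aα≡ Bβ≡
  where
  open ℚ.≤-Reasoning
  open +-*-Solver
  step : ∀ {C γ} s t → ∣ s ∣ ℚ.≤ C → ∣ t ∣ ℚ.< γ → Positive C → C ℚ.* γ ≡ ½ ℚ.* ε →
         ∣ s ℚ.* t ∣ ℚ.< ½ ℚ.* ε
  step {C} {γ} s t h k C>0 e = begin-strict
    ∣ s ℚ.* t ∣        ≡⟨ ℚ.∣p*q∣≡∣p∣*∣q∣ s t ⟩
    ∣ s ∣ ℚ.* ∣ t ∣    ≤⟨ ℚ.*-monoʳ-≤-nonNeg ∣ t ∣ {{ℚ.∣-∣-nonNeg t}} h ⟩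
    C ℚ.* ∣ t ∣        <⟨ ℚ.*-monoʳ-<-pos C {{C>0}} k ⟩
    C ℚ.* γ            ≡⟨ e ⟩
    ½ ℚ.* ε            ∎
  bound : ∀ {A B α β} p p′ q q′ →
          ∣ p ∣ ℚ.≤ A → ∣ q′ ∣ ℚ.≤ B → ∣ p ℚ.- p′ ∣ ℚ.< β → ∣ q ℚ.- q′ ∣ ℚ.< α →
          Positive A → Positive B → A ℚ.* α ≡ ½ ℚ.* ε → B ℚ.* β ≡ ½ ℚ.* ε →
          ∣ p ℚ.* q ℚ.- p′ ℚ.* q′ ∣ ℚ.< ε
  bound p p′ q q′ hp hq dp dq A>0 B>0 eA eB = begin-strict
    ∣ p ℚ.* q ℚ.- p′ ℚ.* q′ ∣
      ≡⟨ cong ∣_∣ (solve 4 (λ a a′ b b′ → a :* b :- a′ :* b′ := a :* (b :- b′) :+ b′ :* (a :- a′))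
           refl p p′ q q′) ⟩
    ∣ p ℚ.* (q ℚ.- q′) ℚ.+ q′ ℚ.* (p ℚ.- p′) ∣
      ≤⟨ ℚ.∣p+q∣≤∣p∣+∣q∣ (p ℚ.* (q ℚ.- q′)) (q′ ℚ.* (p ℚ.- p′)) ⟩
    ∣ p ℚ.* (q ℚ.- q′) ∣ ℚ.+ ∣ q′ ℚ.* (p ℚ.- p′) ∣
      <⟨ ℚ.+-mono-< (step p (q ℚ.- q′) hp dq A>0 eA) (step q′ (p ℚ.- p′) hq dp B>0 eB) ⟩
    ½ ℚ.* ε ℚ.+ ½ ℚ.* ε
      ≡⟨ ½ε+½ε≡ε ε ⟩
    ε ∎

Matrix : ℕ → Set
Matrix n = Fin n → Fin n → ℝ

infix 4 _≈ᵛ_ _≤ᵛ_ _≯ᵛ_ _≈ᴹ_ _≤ᴹ_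

_≈ᵛ_ _≤ᵛ_ _≯ᵛ_ : ∀ {n} → Vector ℝ n → Vector ℝ n → Set
u ≈ᵛ v = ∀ i → u i ≈ᴿ v i
u ≤ᵛ v = ∀ i → u i ≤ᴿ v i
u ≯ᵛ v = ∃[ i ] u i ≤ᴿ v i

_≈ᴹ_ _≤ᴹ_ : ∀ {n} → Matrix n → Matrix n → Set
A ≈ᴹ B = ∀ i j → A i j ≈ᴿ B i j
A ≤ᴹ B = ∀ i j → A i j ≤ᴿ B i j

𝟎 𝟏 : ∀ {n} → Vector ℝ n
𝟎 _ = 0ᴿ
𝟏 _ = 1ᴿ

𝟎ᴹ 𝐈 : ∀ {n} → Matrix n
𝟎ᴹ _ _ = 0ᴿ
𝐈 i j = if does (i Fin.≟ j) then 1ᴿ else 0ᴿ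

sum : ∀ {n} → Vector ℝ n → ℝ
sum = foldr _+ᴿ_ 0ᴿ

infixr 7 _·ᵛ_ _·ᴹ_

_·ᵛ_ : ∀ {n} → Matrix n → Vector ℝ n → Vector ℝ n
(A ·ᵛ v) i = sum (λ j → A i j *ᴿ v j)

_·ᴹ_ : ∀ {n} → Matrix n → Matrix n → Matrix n
(A ·ᴹ B) i k = sum (λ j → A i j *ᴿ B j k)

_IsInverseOf_ : ∀ {n} → Matrix n → Matrix n → Set
B IsInverseOf A = (A ·ᴹ B ≈ᴹ 𝐈) × (B ·ᴹ A ≈ᴹ 𝐈)

-- Asymmetry of the arc relation excludes both loops and pairs of opposite
-- arcs; irreflexivity is nevertheless listed separately.
record Digraph : Set where
  field
    order    : ℕ
    nonEmpty : ℕ.NonZero order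
    arc      : Fin order → Fin order → Bool
    noLoop   : ∀ u → ¬ T (arc u u)
    simple   : ∀ u v → T (arc u v) → ¬ T (arc v u)

  V : Set
  V = Fin order

  data Walk : ℕ → V → V → Set where
    []  : ∀ {u} → Walk 0 u u
    _∷_ : ∀ {k u v w} → T (arc u v) → Walk k v w → Walk (suc k) u w

  vertices : ∀ {k u v} → Walk k u v → List V
  vertices {u = u} []      = u ∷ []
  vertices {u = u} (_ ∷ p) = u ∷ vertices p

  Path : ℕ → V → V → Set
  Path k u v = Σ[ p ∈ Walk k u v ] Unique (vertices p)

  -- d⟨ u , v ⟩≡ k  says that d(u,v) = k.  It holds for no k when d(u,v) = ∞.
  d⟨_,_⟩≡_ : V → V → ℕ → Set
  d⟨ u , v ⟩≡ k = Path k u v × (∀ {j} → j ℕ.< k → ¬ Path j u v)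

  ∃Walk? : ∀ k u v {Q : Walk k u v → Set} → (∀ p → Dec (Q p)) → Dec (∃ Q)
  ∃Walk? zero u v {Q} Q? with u Fin.≟ v
  ... | yes refl = map′ ([] ,_) (λ { ([] , q) → q }) (Q? [])
  ... | no u≢v   = no λ { ([] , _) → u≢v refl }
  ∃Walk? (suc k) u w {Q} Q? = map′ to from (Fin.any? step?)
    where
    Step : V → Set
    Step v = Σ[ a ∈ T (arc u v) ] Σ[ p ∈ Walk k v w ] Q (a ∷ p)
    step? : ∀ v → Dec (Step v)
    step? v with T? (arc u v)
    ... | no ¬a = no λ (a , _) → ¬a a
    ... | yes a = map′ (a ,_)
                    (λ (a′ , r) → subst (λ a → Σ[ p ∈ Walk k v w ] Q (a ∷ p)) (T-irrelevant a′ a) r)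
                    (∃Walk? k v w (λ p → Q? (a ∷ p)))
    to : ∃ Step → ∃ Q
    to (_ , a , p , q) = a ∷ p , q
    from : ∃ Q → ∃ Step
    from (a ∷ p , q) = _ , a , p , q

  path? : ∀ k u v → Dec (Path k u v)
  path? k u v = ∃Walk? k u v (λ p → DecUnique.unique? Fin._≟_ (vertices p))

  d⟨_,_⟩≟_ : ∀ u v k → Dec (d⟨ u , v ⟩≡ k)
  d⟨ u , v ⟩≟ k = path? k u v ×-dec ℕ.allUpTo? (λ j → ¬? (path? j u v)) k

  d⁺ d⁺⁺ : V → ℕ
  d⁺  v = length (filter (λ u → d⟨ v , u ⟩≟ 1) (allFin order))
  d⁺⁺ v = length (filter (λ u → d⟨ v , u ⟩≟ 2) (allFin order))

  S : Matrix order
  S i j = if does (d⟨ i , j ⟩≟ 1) then 1ᴿ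
          else if does (d⟨ i , j ⟩≟ 2) then -ᴿ 1ᴿ
          else 0ᴿ

  IsWeight : Vector ℝ order → Set
  IsWeight w = 𝟎 ≤ᵛ w

open Digraph public using (order; V; d⁺; d⁺⁺; S; IsWeight)

AllEquivalent : ∀ {n} → Vec Set n → Set
AllEquivalent Ps = ∀ i j → Vec.lookup Ps i → Vec.lookup Ps j

{-# OPTIONS --safe #-}
module Submission where

-- The entries of S D are rational, and all linear algebra is done over ℚ.
-- A positive rational weight vector with positive image can be scaled to ℕ and
-- turned into a blow-up of D that violates (2); this gives (2) ⇒ (3).  Reversing
-- all arcs transposes S D, so Ville's theorem of the alternative gives (3) ⇒ (4).
-- For (6) ⇒ (1), in a digraph of minimal order admitting a weight vector w with
-- S w > 0 the inequality S v ≤ 0 forces v ≤ 0: otherwise some combination of w and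
-- v is a weight vector that still has positive image but vanishes at a vertex, and
-- deleting that vertex only increases the other entries of S.  A square matrix
-- that reflects signs in this way has a nonnegative inverse.

open import Defs
open import Algebra.Bundles using (CommutativeRing)
import Algebra.Properties.Semiring.Mult
import Algebra.Properties.Semiring.Sum
open import Axiom.ExcludedMiddle using (ExcludedMiddle)
open import Data.Bool using (T; T?; true; false; if_then_else_)
open import Data.Fin using (Fin; zero; suc; punchIn; fromℕ<)
open import Data.Fin.Patterns using (0F; 1F; 2F; 3F; 4F; 5F)
import Data.Fin.Properties as Fin
import Data.Integer as ℤ
import Data.Integer.Tactic.RingSolver as ℤ-Solver
open import Data.List using
  (List; []; _∷_; _++_; filter; map; length; lookup; replicate; concatMap; tabulate; allFin;
   cartesianProductWith)
import Data.List.Extrema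
open import Data.List.Membership.Propositional using (_∈_; lose)
open import Data.List.Membership.Propositional.Properties using
  (∈-++⁺ˡ; ∈-++⁺ʳ; ∈-++⁻; ∈-filter⁺; ∈-filter⁻; ∈-map⁺; ∈-map⁻; ∈-allFin; ∈-concatMap⁺;
   ∈-cartesianProductWith⁺; ∈-cartesianProductWith⁻)
open import Data.List.Relation.Unary.All as All using ([]; _∷_)
open import Data.List.Relation.Unary.AllPairs using ([]; _∷_)
open import Data.List.Relation.Unary.Any as Any using (here; there)
import Data.List.Relation.Unary.Any.Properties as Any
open import Data.Nat as ℕ using (ℕ; zero; suc; z≤n; s≤s; _≤_)
import Data.Nat.Properties as ℕ
open import Data.Product using (Σ-syntax; ∃; ∃-syntax; _×_; _,_; proj₁; proj₂)
open import Data.Rational as ℚ using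
  (ℚ; mkℚ; 0ℚ; 1ℚ; ½; ∣_∣; _+_; _*_; -_; _-_; positive; nonNegative; toℚᵘ)
import Data.Rational.Properties as ℚ
open import Data.Rational.Solver using (module +-*-Solver)
open import Data.Rational.Unnormalised as ℚᵘ using (mkℚᵘ; *≡*)
import Data.Rational.Unnormalised.Properties as ℚᵘ
open import Data.Sum using (_⊎_; inj₁; inj₂)
open import Data.Vec as Vec using (_∷_; [])
open import Data.Vec.Functional using (Vector; insertAt; removeAt) renaming (_∷_ to _◂_)
open import Data.Vec.Functional.Properties using (insertAt-lookup; insertAt-punchIn)
open import Function using (_∘_; const; id; flip; case_of_)
open import Level using (0ℓ)
open import Relation.Binary.Bundles using (DecTotalOrder)
open import Relation.Binary.PropositionalEquality
  using (_≡_; _≢_; refl; sym; trans; cong; cong₂; subst; subst₂; module ≡-Reasoning)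
open import Relation.Nullary using (¬_; Dec; yes; no; does; contradiction)
open import Relation.Nullary.Decidable using (dec-true; dec-false; ¬?; decidable-stable; _×-dec_)

open Algebra.Properties.Semiring.Sum (CommutativeRing.semiring ℚ.+-*-commutativeRing)
  using (sum-cong-≗; sum-remove; ∑-distrib-+; ∑-comm; *-distribˡ-sum; *-distribʳ-sum)
  renaming (sum to ∑)
open Algebra.Properties.Semiring.Mult (CommutativeRing.semiring ℚ.+-*-commutativeRing)
  using (×-assocˡ; ×-assoc-*)
  renaming (_×_ to _·_)
open Data.List.Extrema (DecTotalOrder.totalOrder ℚ.≤-decTotalOrder) using (argmax; f[xs]≤f[argmax])
open +-*-Solver using (solve; con; _:+_; _:*_; _:-_; :-_; _:=_)
open Digraph using (arc; d⟨_,_⟩≡_; d⟨_,_⟩≟_; noLoop; simple; nonEmpty)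

-- Ordered field lemmas

-- The implications form the single cycle (1) ⇒ (2) ⇒ ... ⇒ (6) ⇒ (1). Excluded middle enters only
-- (2) ⇒ (3) and (4) ⇒ (5), where a vertex has to be extracted from inequalities between Cauchy
-- reals, which are undecidable; the other steps compare rationals or natural numbers, or estimate
-- terms of sequences.
--
-- A recurring device is to add a fixed correction to a large multiple of a vector: strict
-- inequalities survive, and what was only nonnegative becomes positive. It turns a weight vector
-- into one with all entries positive, so that every vertex gets a copy in the blow-up and division
-- by entries is possible, and it supplies the strictness in Fourier-Motzkin elimination.
--
-- In (5) ⇒ (6) the inverse and the vector are both arbitrary reals. There an exact identity holds
-- at every index of the sequences, and the signs and the equation `B S = I`, which hold only up to
-- a tolerance, are paid for by error estimates.

pos+pos : ∀ {p q} → 0ℚ ℚ.< p → 0ℚ ℚ.< q → 0ℚ ℚ.< p + q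
pos+pos = ℚ.+-mono-<

pos+nonNeg : ∀ {p q} → 0ℚ ℚ.< p → 0ℚ ℚ.≤ q → 0ℚ ℚ.< p + q
pos+nonNeg = ℚ.+-mono-<-≤

pos*pos : ∀ {p q} → 0ℚ ℚ.< p → 0ℚ ℚ.< q → 0ℚ ℚ.< p * q
pos*pos {p} {q} 0<p 0<q = ℚ.positive⁻¹ (p * q)
  {{ℚ.pos*pos⇒pos p {{positive 0<p}} q {{positive 0<q}}}}

nonNeg*nonNeg : ∀ {p q} → 0ℚ ℚ.≤ p → 0ℚ ℚ.≤ q → 0ℚ ℚ.≤ p * q
nonNeg*nonNeg {p} {q} 0≤p 0≤q = ℚ.nonNegative⁻¹ (p * q)
  {{ℚ.nonNeg*nonNeg⇒nonNeg p {{nonNegative 0≤p}} q {{nonNegative 0≤q}}}}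

pos-cancelˡ : ∀ {p q} → 0ℚ ℚ.< p → 0ℚ ℚ.< p * q → 0ℚ ℚ.< q
pos-cancelˡ {p} {q} 0<p 0<pq =
  ℚ.*-cancelˡ-<-nonNeg p {{nonNegative (ℚ.<⇒≤ 0<p)}} (subst (ℚ._< p * q) (sym (ℚ.*-zeroʳ p)) 0<pq)

neg⇒0<- : ∀ {p} → p ℚ.< 0ℚ → 0ℚ ℚ.< - p
neg⇒0<- = ℚ.neg-antimono-<

nonPos⇒0≤- : ∀ {p} → p ℚ.≤ 0ℚ → 0ℚ ℚ.≤ - p
nonPos⇒0≤- = ℚ.neg-antimono-≤

0≤-⇒nonPos : ∀ {p} → 0ℚ ℚ.≤ - p → p ℚ.≤ 0ℚ
0≤-⇒nonPos {p} h = subst (ℚ._≤ 0ℚ) (solve 1 (λ p → :- (:- p) := p) refl p) (ℚ.neg-antimono-≤ h)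

<⇒≱ : ∀ {p q} → p ℚ.< q → ¬ q ℚ.≤ p
<⇒≱ p<q q≤p = ℚ.<-irrefl refl (ℚ.<-≤-trans p<q q≤p)

0<1 : 0ℚ ℚ.< 1ℚ
0<1 = ℚ.positive⁻¹ 1ℚ

p≤∣p∣ : ∀ p → p ℚ.≤ ∣ p ∣
p≤∣p∣ p with ℚ.≤-total 0ℚ p
... | inj₁ 0≤p = ℚ.≤-reflexive (sym (ℚ.0≤p⇒∣p∣≡p 0≤p))
... | inj₂ p≤0 = ℚ.≤-trans p≤0 (ℚ.0≤∣p∣ p)

-p≤∣p∣ : ∀ p → - p ℚ.≤ ∣ p ∣
-p≤∣p∣ p = subst (- p ℚ.≤_) (ℚ.∣-p∣≡∣p∣ p) (p≤∣p∣ (- p))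

reciprocal : ∀ {p} → 0ℚ ℚ.< p → ∃[ r ] (0ℚ ℚ.< r × r * p ≡ 1ℚ)
reciprocal {p} 0<p = ℚ.1/ p , ℚ.positive⁻¹ (ℚ.1/ p) {{ℚ.1/pos⇒pos p}} , ℚ.*-inverseˡ p
  where
  instance
    _ = positive 0<p
    _ = ℚ.pos⇒nonZero p

-- Finite sums and dot products

∑-nonNeg : ∀ {n} {f : Vector ℚ n} → (∀ i → 0ℚ ℚ.≤ f i) → 0ℚ ℚ.≤ ∑ f
∑-nonNeg {zero}  0≤f = ℚ.≤-refl
∑-nonNeg {suc n} 0≤f = ℚ.+-mono-≤ (0≤f zero) (∑-nonNeg (0≤f ∘ suc))

∑-mono-≤ : ∀ {n} {f g : Vector ℚ n} → (∀ i → f i ℚ.≤ g i) → ∑ f ℚ.≤ ∑ g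
∑-mono-≤ {zero}  f≤g = ℚ.≤-refl
∑-mono-≤ {suc n} f≤g = ℚ.+-mono-≤ (f≤g zero) (∑-mono-≤ (f≤g ∘ suc))

∑-zero : ∀ {n} {f : Vector ℚ n} → (∀ i → f i ≡ 0ℚ) → ∑ f ≡ 0ℚ
∑-zero {zero}  f≡0 = refl
∑-zero {suc n} f≡0 = cong₂ _+_ (f≡0 zero) (∑-zero (f≡0 ∘ suc))

infix 8 _∙_
_∙_ : ∀ {n} → Vector ℚ n → Vector ℚ n → ℚ
a ∙ x = ∑ (λ j → a j * x j)

∙-comm : ∀ {n} (a x : Vector ℚ n) → a ∙ x ≡ x ∙ a
∙-comm a x = sum-cong-≗ (λ j → ℚ.*-comm (a j) (x j))

∙-combineʳ : ∀ {n} (a : Vector ℚ n) p x q z →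
             a ∙ (λ j → p * x j + q * z j) ≡ p * (a ∙ x) + q * (a ∙ z)
∙-combineʳ a p x q z = begin
  ∑ (λ j → a j * (p * x j + q * z j))
    ≡⟨ sum-cong-≗ (λ j → solve 5 (λ a p x q z → a :* (p :* x :+ q :* z) := p :* (a :* x) :+ q :* (a :* z))
         refl (a j) p (x j) q (z j)) ⟩
  ∑ (λ j → p * (a j * x j) + q * (a j * z j))
    ≡⟨ ∑-distrib-+ (λ j → p * (a j * x j)) (λ j → q * (a j * z j)) ⟩
  ∑ (λ j → p * (a j * x j)) + ∑ (λ j → q * (a j * z j))
    ≡⟨ cong₂ _+_ (*-distribˡ-sum p (λ j → a j * x j)) (*-distribˡ-sum q (λ j → a j * z j)) ⟨
  p * (a ∙ x) + q * (a ∙ z) ∎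
  where open ≡-Reasoning

∙-combineˡ : ∀ {n} p (a : Vector ℚ n) q b x →
             (λ j → p * a j + q * b j) ∙ x ≡ p * (a ∙ x) + q * (b ∙ x)
∙-combineˡ p a q b x = begin
  (λ j → p * a j + q * b j) ∙ x  ≡⟨ ∙-comm (λ j → p * a j + q * b j) x ⟩
  x ∙ (λ j → p * a j + q * b j)  ≡⟨ ∙-combineʳ x p a q b ⟩
  p * (x ∙ a) + q * (x ∙ b)      ≡⟨ cong₂ (λ s t → p * s + q * t) (∙-comm x a) (∙-comm x b) ⟩
  p * (a ∙ x) + q * (b ∙ x)      ∎
  where open ≡-Reasoning

∙-assoc : ∀ {m n} (a : Vector ℚ m) (B : Fin m → Fin n → ℚ) (x : Vector ℚ n) →
          a ∙ (λ j → B j ∙ x) ≡ (λ k → a ∙ (λ j → B j k)) ∙ x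
∙-assoc a B x = begin
  ∑ (λ j → a j * ∑ (λ k → B j k * x k))
    ≡⟨ sum-cong-≗ (λ j → *-distribˡ-sum (a j) (λ k → B j k * x k)) ⟩
  ∑ (λ j → ∑ (λ k → a j * (B j k * x k)))
    ≡⟨ ∑-comm (λ j k → a j * (B j k * x k)) ⟩
  ∑ (λ k → ∑ (λ j → a j * (B j k * x k)))
    ≡⟨ sum-cong-≗ (λ k → trans (sum-cong-≗ (λ j → sym (ℚ.*-assoc (a j) (B j k) (x k))))
                               (sym (*-distribʳ-sum (x k) (λ j → a j * B j k)))) ⟩
  ∑ (λ k → ∑ (λ j → a j * B j k) * x k) ∎
  where open ≡-Reasoning

δ : ∀ {n} → Fin n → Vector ℚ n
δ i j = if does (i Fin.≟ j) then 1ℚ else 0ℚ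

δ-refl : ∀ {n} (i : Fin n) → δ i i ≡ 1ℚ
δ-refl i = cong (λ b → if b then 1ℚ else 0ℚ) (dec-true (i Fin.≟ i) refl)

δ-≢ : ∀ {n} {i j : Fin n} → i ≢ j → δ i j ≡ 0ℚ
δ-≢ {i = i} {j} i≢j = cong (λ b → if b then 1ℚ else 0ℚ) (dec-false (i Fin.≟ j) i≢j)

δ-sym : ∀ {n} (i j : Fin n) → δ i j ≡ δ j i
δ-sym i j with i Fin.≟ j
... | yes refl = sym (δ-refl i)
... | no i≢j = sym (δ-≢ (i≢j ∘ sym))

δ-nonNeg : ∀ {n} (i j : Fin n) → 0ℚ ℚ.≤ δ i j
δ-nonNeg i j with i Fin.≟ j
... | yes _ = ℚ.<⇒≤ 0<1
... | no _  = ℚ.≤-refl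

δ-∙ : ∀ {n} (i : Fin n) (x : Vector ℚ n) → δ i ∙ x ≡ x i
δ-∙ {suc n} i x = begin
  δ i ∙ x                                            ≡⟨ sum-remove {i = i} (λ j → δ i j * x j) ⟩
  δ i i * x i + ∑ (removeAt (λ j → δ i j * x j) i)   ≡⟨ cong₂ _+_
    (trans (cong (_* x i) (δ-refl i)) (ℚ.*-identityˡ (x i))) (∑-zero rest) ⟩
  x i + 0ℚ                                           ≡⟨ ℚ.+-identityʳ (x i) ⟩
  x i                                                ∎
  where
  open ≡-Reasoning
  rest : ∀ k → removeAt (λ j → δ i j * x j) i k ≡ 0ℚ
  rest k = trans (cong (_* x (punchIn i k)) (δ-≢ (Fin.punchInᵢ≢i i k ∘ sym))) (ℚ.*-zeroˡ (x (punchIn i k)))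

-- Homogeneous linear systems

-- Gaussian elimination with a pivot `a` in the first row. The reduced rows are multiplied by `a`
-- instead of dividing by it; accordingly `lift` scales the remaining coordinates by `a` and chooses
-- the pivot coordinate so that the first row vanishes.
underdetermined : ∀ m (A : Fin m → Vector ℚ (suc m)) →
                  ∃[ x ] (∃[ j ] x j ≢ 0ℚ) × (∀ i → A i ∙ x ≡ 0ℚ)
underdetermined zero    A = const 1ℚ , (zero , λ ()) , λ ()
underdetermined (suc m) A with Fin.any? (λ j → ¬? (A zero j ℚ.≟ 0ℚ))
... | no ¬pivot =
  let x , (j , xj≢0) , Ax≡0 = underdetermined m (λ i → A (suc i) ∘ suc)
  in 0ℚ ◂ x , (suc j , xj≢0) , λ where
    zero    → ∑-zero (λ j → trans (cong (_* (0ℚ ◂ x) j)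
                (decidable-stable (A zero j ℚ.≟ 0ℚ) (λ ≢0 → ¬pivot (j , ≢0))))
                (ℚ.*-zeroˡ ((0ℚ ◂ x) j)))
    (suc i) → trans (cong₂ _+_ (ℚ.*-zeroʳ (A (suc i) zero)) (Ax≡0 i)) (ℚ.+-identityˡ 0ℚ)
... | yes (p , a≢0) =
  let x , (j , xj≢0) , Ax≡0 = underdetermined m reduced
  in lift x ,
     (punchIn p j , λ e → xj≢0 (cancel (trans (sym (insertAt-punchIn (λ k → a * x k) p (- (rest ∙ x)) j)) e))) ,
     λ where
    zero    → trans (expand x zero)
                (solve 2 (λ a r → a :* (:- r) :+ a :* r := con 0ℚ) refl a (rest ∙ x))
    (suc i) → trans (expand x (suc i)) (trans (regroup x i) (Ax≡0 i))
  where
  open ≡-Reasoning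
  a : ℚ
  a = A zero p
  rest : Vector ℚ (suc m)
  rest = removeAt (A zero) p
  reduced : Fin m → Vector ℚ (suc m)
  reduced i k = a * removeAt (A (suc i)) p k + - A (suc i) p * rest k
  lift : Vector ℚ (suc m) → Vector ℚ (suc (suc m))
  lift x = insertAt (λ k → a * x k) p (- (rest ∙ x))
  cancel : ∀ {q} → a * q ≡ 0ℚ → q ≡ 0ℚ
  cancel {q} aq≡0 = begin
    q                    ≡⟨ ℚ.*-identityˡ q ⟨
    1ℚ * q               ≡⟨ cong (_* q) (ℚ.*-inverseˡ a) ⟨
    (ℚ.1/ a) * a * q     ≡⟨ ℚ.*-assoc (ℚ.1/ a) a q ⟩
    (ℚ.1/ a) * (a * q)   ≡⟨ cong (ℚ.1/ a *_) aq≡0 ⟩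
    (ℚ.1/ a) * 0ℚ        ≡⟨ ℚ.*-zeroʳ (ℚ.1/ a) ⟩
    0ℚ                   ∎
    where instance _ = ℚ.≢-nonZero a≢0
  expand : ∀ x i → A i ∙ lift x ≡ A i p * (- (rest ∙ x)) + a * (removeAt (A i) p ∙ x)
  expand x i = begin
    A i ∙ lift x
      ≡⟨ sum-remove {i = p} (λ j → A i j * lift x j) ⟩
    A i p * lift x p + ∑ (λ k → A i (punchIn p k) * lift x (punchIn p k))
      ≡⟨ cong₂ _+_ (cong (A i p *_) (insertAt-lookup (λ k → a * x k) p (- (rest ∙ x))))
           (sum-cong-≗ (λ k → trans
             (cong (A i (punchIn p k) *_) (insertAt-punchIn (λ k → a * x k) p (- (rest ∙ x)) k))
             (solve 3 (λ b a x → b :* (a :* x) := a :* (b :* x)) refl (A i (punchIn p k)) a (x k)))) ⟩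
    A i p * (- (rest ∙ x)) + ∑ (λ k → a * (removeAt (A i) p k * x k))
      ≡⟨ cong (A i p * (- (rest ∙ x)) +_) (*-distribˡ-sum a (λ k → removeAt (A i) p k * x k)) ⟨
    A i p * (- (rest ∙ x)) + a * (removeAt (A i) p ∙ x) ∎
  regroup : ∀ x i → A (suc i) p * (- (rest ∙ x)) + a * (removeAt (A (suc i)) p ∙ x) ≡ reduced i ∙ x
  regroup x i = begin
    A (suc i) p * (- (rest ∙ x)) + a * (removeAt (A (suc i)) p ∙ x)
      ≡⟨ solve 4 (λ b r a s → b :* (:- r) :+ a :* s := a :* s :+ (:- b) :* r) refl
           (A (suc i) p) (rest ∙ x) a (removeAt (A (suc i)) p ∙ x) ⟩
    a * (removeAt (A (suc i)) p ∙ x) + - A (suc i) p * (rest ∙ x)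
      ≡⟨ ∙-combineˡ a (removeAt (A (suc i)) p) (- A (suc i) p) rest x ⟨
    reduced i ∙ x ∎

-- Ville's theorem of the alternative

-- The factor only grows along the list: the increment `N` for a new head contributes a positive
-- multiple of `u` wherever `u` is positive, so earlier bounds persist. Taking `N` to be
-- `(1 + ∣ρ∣) / u` at the head outweighs `ρ` there.
dominate : ∀ {A : Set} (L : List A) (u ρ : A → ℚ) →
           ∃[ M ] 0ℚ ℚ.< M × (∀ {x} → x ∈ L → 0ℚ ℚ.< u x → 0ℚ ℚ.< M * u x + ρ x)
dominate []      u ρ = 1ℚ , 0<1 , λ ()
dominate (a ∷ L) u ρ with dominate L u ρ | 0ℚ ℚ.<? u a
... | M , 0<M , bound | no u≯0 = M , 0<M , λ where
  (here refl) 0<u → contradiction 0<u u≯0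
  (there x∈L)     → bound x∈L
... | M , 0<M , bound | yes 0<ua with r , 0<r , r*u≡1 ← reciprocal 0<ua =
  M + N , pos+pos 0<M 0<N , λ where
    (here refl) _   → subst (0ℚ ℚ.<_) (atHead (u a) (ρ a) r*u≡1)
                        (pos+pos (pos*pos 0<M 0<ua) (pos+nonNeg 0<1 0≤∣ρ∣+ρ))
    (there x∈L) 0<u → subst (0ℚ ℚ.<_)
      (solve 4 (λ M N u ρ → (M :* u :+ ρ) :+ N :* u := (M :+ N) :* u :+ ρ) refl M N (u _) (ρ _))
      (pos+pos (bound x∈L 0<u) (pos*pos 0<N 0<u))
  where
  N : ℚ
  N = r * (1ℚ + ∣ ρ a ∣)
  0<N : 0ℚ ℚ.< N
  0<N = pos*pos 0<r (pos+nonNeg 0<1 (ℚ.0≤∣p∣ (ρ a)))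
  0≤∣ρ∣+ρ : 0ℚ ℚ.≤ ∣ ρ a ∣ + ρ a
  0≤∣ρ∣+ρ = subst (ℚ._≤ ∣ ρ a ∣ + ρ a) (ℚ.+-inverseˡ (ρ a))
    (ℚ.+-monoˡ-≤ (ρ a) (-p≤∣p∣ (ρ a)))
  atHead : ∀ u ρ → r * u ≡ 1ℚ → M * u + (1ℚ + (∣ ρ ∣ + ρ)) ≡ (M + r * (1ℚ + ∣ ρ ∣)) * u + ρ
  atHead u ρ ru≡1 = sym (begin
    (M + r * (1ℚ + ∣ ρ ∣)) * u + ρ
      ≡⟨ solve 5 (λ M r b u ρ → (M :+ r :* b) :* u :+ ρ := M :* u :+ ((r :* u) :* b :+ ρ)) refl
           M r (1ℚ + ∣ ρ ∣) u ρ ⟩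
    M * u + (r * u * (1ℚ + ∣ ρ ∣) + ρ)
      ≡⟨ cong (λ c → M * u + (c * (1ℚ + ∣ ρ ∣) + ρ)) ru≡1 ⟩
    M * u + (1ℚ * (1ℚ + ∣ ρ ∣) + ρ)
      ≡⟨ cong (M * u +_) (solve 2 (λ b ρ → con 1ℚ :* (con 1ℚ :+ b) :+ ρ := con 1ℚ :+ (b :+ ρ)) refl ∣ ρ ∣ ρ) ⟩
    M * u + (1ℚ + (∣ ρ ∣ + ρ)) ∎)
    where open ≡-Reasoning

-- Positivity of `s * φ + t * ρ` bounds the multiplier `t / s` from below by `- φ / ρ` where `ρ` is
-- positive and from above by `φ / - ρ` where `ρ` is negative. `mixed` puts every lower bound
-- strictly below every upper bound, and `nonPos` makes the multiplier 0 compatible with all upper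
-- bounds.
module _ {A : Set} (L : List A) (φ ρ : A → ℚ)
  (nonPos : ∀ {x} → x ∈ L → ρ x ℚ.≤ 0ℚ → 0ℚ ℚ.< φ x)
  (mixed  : ∀ {x z} → x ∈ L → z ∈ L → 0ℚ ℚ.< ρ x → ρ z ℚ.< 0ℚ → 0ℚ ℚ.< ρ x * φ z + - ρ z * φ x)
  where

  -- t / s is the least admissible value of the multiplier of ρ.
  leastMultiplier : ∀ Y → (∀ {x} → x ∈ Y → x ∈ L) →
    ∃[ s ] ∃[ t ] 0ℚ ℚ.< s × 0ℚ ℚ.≤ t
    × (∀ {z} → z ∈ L → ρ z ℚ.≤ 0ℚ → 0ℚ ℚ.< s * φ z + t * ρ z)
    × (∀ {x} → x ∈ Y → 0ℚ ℚ.< ρ x → 0ℚ ℚ.≤ s * φ x + t * ρ x)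
  leastMultiplier [] _ = 1ℚ , 0ℚ , 0<1 , ℚ.≤-refl ,
    (λ {z} z∈L ρz≤0 → subst (0ℚ ℚ.<_)
      (solve 2 (λ f r → f := con 1ℚ :* f :+ con 0ℚ :* r) refl (φ z) (ρ z)) (nonPos z∈L ρz≤0)) , λ ()
  leastMultiplier (a ∷ Y) Y⊆L with leastMultiplier Y (Y⊆L ∘ there)
  ... | s , t , 0<s , 0≤t , onL , onY with 0ℚ ℚ.<? ρ a | 0ℚ ℚ.≤? s * φ a + t * ρ a
  ... | no ρa≯0 | _       = s , t , 0<s , 0≤t , onL , λ where
    (here refl) 0<ρa → contradiction 0<ρa ρa≯0
    (there x∈Y)      → onY x∈Y
  ... | yes _   | yes 0≤a = s , t , 0<s , 0≤t , onL , λ where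
    (here refl) _ → 0≤a
    (there x∈Y)   → onY x∈Y
  -- The new multiplier `- φ a / ρ a` makes the constraint at `a` an equality. It exceeds the old
  -- one, which violated that constraint, so the lower bounds already treated remain satisfied.
  ... | yes 0<ρa | no a≱0 = ρ a , - φ a , 0<ρa , ℚ.<⇒≤ 0<-φa , onL′ , onY′
    where
    0<-a : 0ℚ ℚ.< - (s * φ a + t * ρ a)
    0<-a = neg⇒0<- (ℚ.≰⇒> a≱0)
    0<-φa : 0ℚ ℚ.< - φ a
    0<-φa = pos-cancelˡ 0<s (subst (0ℚ ℚ.<_)
      (solve 4 (λ s f t r → (:- (s :* f :+ t :* r)) :+ t :* r := s :* (:- f)) refl s (φ a) t (ρ a))
      (pos+nonNeg 0<-a (nonNeg*nonNeg 0≤t (ℚ.<⇒≤ 0<ρa))))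
    onL′ : ∀ {z} → z ∈ L → ρ z ℚ.≤ 0ℚ → 0ℚ ℚ.< ρ a * φ z + - φ a * ρ z
    onL′ {z} z∈L ρz≤0 with ρ z ℚ.<? 0ℚ
    ... | yes ρz<0 = subst (0ℚ ℚ.<_)
      (solve 4 (λ ra fz rz fa → ra :* fz :+ (:- rz) :* fa := ra :* fz :+ (:- fa) :* rz) refl
        (ρ a) (φ z) (ρ z) (φ a))
      (mixed (Y⊆L (here refl)) z∈L 0<ρa ρz<0)
    ... | no ρz≮0 = subst (λ r → 0ℚ ℚ.< ρ a * φ z + - φ a * r) (ℚ.≤-antisym (ℚ.≮⇒≥ ρz≮0) ρz≤0)
      (subst (0ℚ ℚ.<_) (solve 3 (λ ra fz fa → ra :* fz := ra :* fz :+ (:- fa) :* con 0ℚ) refl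
        (ρ a) (φ z) (φ a)) (pos*pos 0<ρa (nonPos z∈L ρz≤0)))
    onY′ : ∀ {x} → x ∈ a ∷ Y → 0ℚ ℚ.< ρ x → 0ℚ ℚ.≤ ρ a * φ x + - φ a * ρ x
    onY′ (here refl) _ = ℚ.≤-reflexive
      (solve 2 (λ r f → con 0ℚ := r :* f :+ (:- f) :* r) refl (ρ a) (φ a))
    onY′ {x} (there x∈Y) 0<ρx = ℚ.<⇒≤ (pos-cancelˡ 0<s (subst (0ℚ ℚ.<_)
      (solve 6 (λ s t ra fa rx fx →
          rx :* (:- (s :* fa :+ t :* ra)) :+ ra :* (s :* fx :+ t :* rx)
          := s :* (ra :* fx :+ (:- fa) :* rx))
        refl s t (ρ a) (φ a) (ρ x) (φ x))
      (pos+nonNeg (pos*pos 0<ρx 0<-a) (nonNeg*nonNeg (ℚ.<⇒≤ 0<ρa) (onY x∈Y 0<ρx)))))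

  -- The least multiplier may give equality where `ρ` is positive. Adding one more `ρ` to a large
  -- multiple repairs this, and the factor `M` protects the strict inequalities where `ρ` is
  -- nonpositive.
  multiplier : ∃[ s ] ∃[ t ] 0ℚ ℚ.< s × 0ℚ ℚ.≤ t × (∀ {x} → x ∈ L → 0ℚ ℚ.< s * φ x + t * ρ x)
  multiplier with s , t , 0<s , 0≤t , onNeg , onPos ← leastMultiplier L id
             with M , 0<M , bound ← dominate L (λ x → s * φ x + t * ρ x) ρ =
    M * s , M * t + 1ℚ , pos*pos 0<M 0<s ,
    ℚ.<⇒≤ (subst (0ℚ ℚ.<_) (ℚ.+-comm 1ℚ (M * t)) (pos+nonNeg 0<1 (nonNeg*nonNeg (ℚ.<⇒≤ 0<M) 0≤t))) ,
    λ {x} x∈L → subst (0ℚ ℚ.<_)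
      (solve 5 (λ M s f t r → M :* (s :* f :+ t :* r) :+ r := M :* s :* f :+ (M :* t :+ con 1ℚ) :* r) refl
        M s (φ x) t (ρ x))
      (perturbed x∈L)
    where
    perturbed : ∀ {x} → x ∈ L → 0ℚ ℚ.< M * (s * φ x + t * ρ x) + ρ x
    perturbed {x} x∈L with 0ℚ ℚ.<? ρ x
    ... | no ρx≯0 = bound x∈L (onNeg x∈L (ℚ.≮⇒≥ ρx≯0))
    ... | yes 0<ρx = subst (0ℚ ℚ.<_) (ℚ.+-comm (ρ x) _)
      (pos+nonNeg 0<ρx (nonNeg*nonNeg (ℚ.<⇒≤ 0<M) (onPos x∈L 0<ρx)))

-- Fourier–Motzkin elimination of the first row.  The set K carries along the
-- sign conditions on the combinations of generators that have been formed.
alternative : ∀ {n} m (A : Fin m → Vector ℚ n) (K : Vector ℚ n → Set) →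
  (∀ {p q x z} → 0ℚ ℚ.< p → 0ℚ ℚ.< q → K x → K z → K (λ j → p * x j + q * z j)) →
  (X : List (Vector ℚ n)) → (∀ {x} → x ∈ X → K x) →
  (∃[ y ] (∀ i → 0ℚ ℚ.≤ y i) × (∀ {x} → x ∈ X → 0ℚ ℚ.< y ∙ (λ i → A i ∙ x)))
  ⊎ (∃[ x ] K x × (∀ i → A i ∙ x ℚ.≤ 0ℚ))
-- With no rows left every `y ∙ _` is the empty sum, so the first alternative needs an empty list of
-- generators; otherwise any generator witnesses the second.
alternative zero    A K closed []      X⊆K = inj₁ ((λ ()) , (λ ()) , λ ())
alternative zero    A K closed (x ∷ X) X⊆K = inj₂ (x , X⊆K (here refl) , λ ())
alternative {n} (suc m) A K closed X X⊆K = conclude (alternative m (A ∘ suc) K′ closed′ X′ X′⊆K′)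
  where
  ρ : Vector ℚ n → ℚ
  ρ x = A zero ∙ x
  K′ : Vector ℚ n → Set
  K′ x = K x × ρ x ℚ.≤ 0ℚ
  closed′ : ∀ {p q x z} → 0ℚ ℚ.< p → 0ℚ ℚ.< q → K′ x → K′ z → K′ (λ j → p * x j + q * z j)
  closed′ {p} {q} {x} {z} 0<p 0<q (Kx , ρx≤0) (Kz , ρz≤0) = closed 0<p 0<q Kx Kz ,
    0≤-⇒nonPos (subst (0ℚ ℚ.≤_)
      (trans (solve 4 (λ p x q z → p :* (:- x) :+ q :* (:- z) := :- (p :* x :+ q :* z)) refl p (ρ x) q (ρ z))
             (cong -_ (sym (∙-combineʳ (A zero) p x q z))))
      (ℚ.+-mono-≤ (nonNeg*nonNeg (ℚ.<⇒≤ 0<p) (nonPos⇒0≤- ρx≤0))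
                  (nonNeg*nonNeg (ℚ.<⇒≤ 0<q) (nonPos⇒0≤- ρz≤0))))
  Pos? = λ x → 0ℚ ℚ.<? ρ x
  Neg? = λ x → ρ x ℚ.<? 0ℚ
  NonPos? = λ x → ρ x ℚ.≤? 0ℚ
  cancelling : Vector ℚ n → Vector ℚ n → Vector ℚ n
  cancelling x z j = ρ x * z j + - ρ z * x j
  -- Generators with negative `ρ` are kept and also cancelled against those with positive `ρ`; the
  -- latter survive only through these cancellations, on which `ρ` vanishes.
  X′ : List (Vector ℚ n)
  X′ = filter NonPos? X ++ cartesianProductWith cancelling (filter Pos? X) (filter Neg? X)
  X′⊆K′ : ∀ {x} → x ∈ X′ → K′ x
  X′⊆K′ x∈ with ∈-++⁻ (filter NonPos? X) x∈
  ... | inj₁ x∈′ = let x∈X , ρx≤0 = ∈-filter⁻ NonPos? x∈′ in X⊆K x∈X , ρx≤0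
  ... | inj₂ x∈′ with x , z , x∈ , z∈ , refl
                       ← ∈-cartesianProductWith⁻ cancelling (filter Pos? X) (filter Neg? X) x∈′
                with x∈X , 0<ρx ← ∈-filter⁻ Pos? x∈ | z∈X , ρz<0 ← ∈-filter⁻ Neg? z∈ =
    closed 0<ρx (neg⇒0<- ρz<0) (X⊆K z∈X) (X⊆K x∈X) ,
    ℚ.≤-reflexive (trans (∙-combineʳ (A zero) (ρ x) z (- ρ z) x)
      (solve 2 (λ a b → a :* b :+ (:- b) :* a := con 0ℚ) refl (ρ x) (ρ z)))
  conclude : (∃[ y ] (∀ i → 0ℚ ℚ.≤ y i) × (∀ {x} → x ∈ X′ → 0ℚ ℚ.< y ∙ (λ i → A (suc i) ∙ x)))
             ⊎ (∃[ x ] K′ x × (∀ i → A (suc i) ∙ x ℚ.≤ 0ℚ)) →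
             (∃[ y ] (∀ i → 0ℚ ℚ.≤ y i) × (∀ {x} → x ∈ X → 0ℚ ℚ.< y ∙ (λ i → A i ∙ x)))
             ⊎ (∃[ x ] K x × (∀ i → A i ∙ x ℚ.≤ 0ℚ))
  conclude (inj₂ (x , (Kx , ρx≤0) , Ax≤0)) = inj₂ (x , Kx , λ { zero → ρx≤0 ; (suc i) → Ax≤0 i })
  conclude (inj₁ (y , 0≤y , 0<φ)) =
    let s , t , 0<s , 0≤t , 0<sφ+tρ = multiplier X φ ρ
          (λ x∈X ρx≤0 → 0<φ (∈-++⁺ˡ (∈-filter⁺ NonPos? x∈X ρx≤0)))
          (λ {x} {z} x∈X z∈X 0<ρx ρz<0 → subst (0ℚ ℚ.<_) (φ-combine (ρ x) z (- ρ z) x)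
            (0<φ (∈-++⁺ʳ (filter NonPos? X)
              (∈-cartesianProductWith⁺ cancelling (∈-filter⁺ Pos? x∈X 0<ρx) (∈-filter⁺ Neg? z∈X ρz<0)))))
    in inj₁ ( (t ◂ (λ i → s * y i))
            , (λ { zero → 0≤t ; (suc i) → nonNeg*nonNeg (ℚ.<⇒≤ 0<s) (0≤y i) })
            , λ {x} x∈X → subst (0ℚ ℚ.<_) (assemble s t x) (0<sφ+tρ x∈X))
    where
    φ : Vector ℚ n → ℚ
    φ x = y ∙ (λ i → A (suc i) ∙ x)
    φ-combine : ∀ p x q z → φ (λ j → p * x j + q * z j) ≡ p * φ x + q * φ z
    φ-combine p x q z = trans
      (sum-cong-≗ (λ i → cong (y i *_) (∙-combineʳ (A (suc i)) p x q z)))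
      (∙-combineʳ y p (λ i → A (suc i) ∙ x) q (λ i → A (suc i) ∙ z))
    assemble : ∀ s t x → s * φ x + t * ρ x ≡ (t ◂ (λ i → s * y i)) ∙ (λ i → A i ∙ x)
    assemble s t x = trans (ℚ.+-comm (s * φ x) (t * ρ x)) (cong (t * ρ x +_)
      (trans (*-distribˡ-sum s (λ i → y i * (A (suc i) ∙ x)))
             (sum-cong-≗ (λ i → sym (ℚ.*-assoc s (y i) (A (suc i) ∙ x))))))

-- The generators are the unit vectors: positivity of `y ∙ (A x)` on them says that every column of
-- `A` has a positive product with `y`, and their positive combinations are nonnegative and
-- non-zero.
ville : ∀ {m n} (A : Fin m → Vector ℚ n) →
  (∃[ y ] (∀ i → 0ℚ ℚ.≤ y i) × (∀ j → 0ℚ ℚ.< y ∙ (λ i → A i j)))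
  ⊎ (∃[ x ] (∀ j → 0ℚ ℚ.≤ x j) × (∃[ j ] 0ℚ ℚ.< x j) × (∀ i → A i ∙ x ℚ.≤ 0ℚ))
ville {m} {n} A with alternative m A K closed (map δ (allFin n)) δ∈K
  where
  K : Vector ℚ n → Set
  K x = (∀ j → 0ℚ ℚ.≤ x j) × (∃[ j ] 0ℚ ℚ.< x j)
  closed : ∀ {p q x z} → 0ℚ ℚ.< p → 0ℚ ℚ.< q → K x → K z → K (λ j → p * x j + q * z j)
  closed 0<p 0<q (0≤x , j , 0<xj) (0≤z , _) =
    (λ k → ℚ.+-mono-≤ (nonNeg*nonNeg (ℚ.<⇒≤ 0<p) (0≤x k)) (nonNeg*nonNeg (ℚ.<⇒≤ 0<q) (0≤z k))) ,
    j , pos+nonNeg (pos*pos 0<p 0<xj) (nonNeg*nonNeg (ℚ.<⇒≤ 0<q) (0≤z j))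
  δ∈K : ∀ {x} → x ∈ map δ (allFin n) → K x
  δ∈K x∈ with j , _ , refl ← ∈-map⁻ δ x∈ = δ-nonNeg j , j , subst (0ℚ ℚ.<_) (sym (δ-refl j)) 0<1
... | inj₁ (y , 0≤y , 0<y) = inj₁ (y , 0≤y , λ j → subst (0ℚ ℚ.<_)
        (sum-cong-≗ (λ i → cong (y i *_) (trans (∙-comm (A i) (δ j)) (δ-∙ j (A i)))))
        (0<y (∈-map⁺ δ (∈-allFin j))))
... | inj₂ (x , (0≤x , 0<xj) , Ax≤0) = inj₂ (x , 0≤x , 0<xj , Ax≤0)

-- Inverse-nonnegative matrices

∙-scaleʳ : ∀ {n} (a : Vector ℚ n) p x → a ∙ (λ j → p * x j) ≡ p * (a ∙ x)
∙-scaleʳ a p x = trans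
  (sum-cong-≗ (λ j → solve 3 (λ a p x → a :* (p :* x) := p :* (a :* x)) refl (a j) p (x j)))
  (sym (*-distribˡ-sum p (λ j → a j * x j)))

Square : ℕ → Set
Square n = Fin n → Vector ℚ n

-- Monotone matrices in the sense of Collatz, written with `≤ 0`; replacing `v` by `- v` gives the
-- usual form.
Monotone : ∀ {n} → Square n → Set
Monotone s = ∀ v → (∀ i → s i ∙ v ℚ.≤ 0ℚ) → ∀ j → v j ℚ.≤ 0ℚ

InverseNonNeg : ∀ {n} → Square n → Set
InverseNonNeg {n} s = Σ[ B ∈ Square n ] (∀ i k → s i ∙ (λ j → B j k) ≡ δ i k)
                       × (∀ i k → B i ∙ (λ j → s j k) ≡ δ i k)
                       × (∀ i k → 0ℚ ℚ.≤ B i k)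

module _ {n} (s : Square n) (mono : Monotone s) where

  monotone⇒reflects-nonNeg : ∀ v → (∀ i → 0ℚ ℚ.≤ s i ∙ v) → ∀ j → 0ℚ ℚ.≤ v j
  monotone⇒reflects-nonNeg v 0≤sv j = subst (0ℚ ℚ.≤_)
    (solve 1 (λ v → :- ((:- con 1ℚ) :* v) := v) refl (v j))
    (nonPos⇒0≤- (mono (λ j → - 1ℚ * v j) (λ i → 0≤-⇒nonPos (subst (0ℚ ℚ.≤_)
      (trans (solve 1 (λ c → c := :- ((:- con 1ℚ) :* c)) refl (s i ∙ v)) (cong -_ (sym (∙-scaleʳ (s i) (- 1ℚ) v))))
      (0≤sv i))) j))

  monotone⇒injective : ∀ v → (∀ i → s i ∙ v ≡ 0ℚ) → ∀ j → v j ≡ 0ℚ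
  monotone⇒injective v sv≡0 j = ℚ.≤-antisym
    (mono v (ℚ.≤-reflexive ∘ sv≡0) j)
    (monotone⇒reflects-nonNeg v (ℚ.≤-reflexive ∘ sym ∘ sv≡0) j)

  -- A non-zero kernel vector of the augmented matrix with columns `- δ k` and `s` solves the system
  -- after division by its first coordinate. That coordinate cannot vanish, because `s` is
  -- injective.
  column : ∀ k → ∃[ b ] (∀ i → s i ∙ b ≡ δ i k)
  column k with x , (j , xj≢0) , ker ← underdetermined n (λ i → (- δ i k) ◂ s i) = invert (x zero ℚ.≟ 0ℚ)
    where
    v : Vector ℚ n
    v = x ∘ suc
    sv≡ : ∀ i → s i ∙ v ≡ δ i k * x zero
    sv≡ i = begin
      s i ∙ v                                         ≡⟨ solve 3 (λ d c r → r := d :* c :+ ((:- d) :* c :+ r)) refl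
                                                             (δ i k) (x zero) (s i ∙ v) ⟩
      δ i k * x zero + (- δ i k * x zero + s i ∙ v)   ≡⟨ cong (δ i k * x zero +_) (ker i) ⟩
      δ i k * x zero + 0ℚ                             ≡⟨ ℚ.+-identityʳ _ ⟩
      δ i k * x zero                                  ∎
      where open ≡-Reasoning
    invert : Dec (x zero ≡ 0ℚ) → ∃[ b ] (∀ i → s i ∙ b ≡ δ i k)
    invert (yes c≡0) = contradiction (x≡0 j) xj≢0
      where
      x≡0 : ∀ j → x j ≡ 0ℚ
      x≡0 zero    = c≡0
      x≡0 (suc j) = monotone⇒injective v
        (λ i → trans (sv≡ i) (trans (cong (δ i k *_) c≡0) (ℚ.*-zeroʳ (δ i k)))) j
    invert (no c≢0) = (λ j → ℚ.1/ x zero * v j) , λ i → begin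
      s i ∙ (λ j → ℚ.1/ x zero * v j)   ≡⟨ ∙-scaleʳ (s i) (ℚ.1/ x zero) v ⟩
      ℚ.1/ x zero * (s i ∙ v)           ≡⟨ cong (ℚ.1/ x zero *_) (trans (sv≡ i) (ℚ.*-comm (δ i k) (x zero))) ⟩
      ℚ.1/ x zero * (x zero * δ i k)    ≡⟨ ℚ.*-assoc (ℚ.1/ x zero) (x zero) (δ i k) ⟨
      ℚ.1/ x zero * x zero * δ i k      ≡⟨ cong (_* δ i k) (ℚ.*-inverseˡ (x zero)) ⟩
      1ℚ * δ i k                        ≡⟨ ℚ.*-identityˡ (δ i k) ⟩
      δ i k                             ∎
      where
      open ≡-Reasoning
      instance _ = ℚ.≢-nonZero c≢0

  monotone⇒inverseNonNeg : InverseNonNeg s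
  monotone⇒inverseNonNeg = B , right , left , λ i k →
    monotone⇒reflects-nonNeg (λ j → B j k)
      (λ i → subst (0ℚ ℚ.≤_) (sym (right i k)) (δ-nonNeg i k)) i
    where
    open ≡-Reasoning
    B : Square n
    B j k = proj₁ (column k) j
    right : ∀ i k → s i ∙ (λ j → B j k) ≡ δ i k
    right i k = proj₂ (column k) i
    -- s (B s - I) = 0 and s is injective.
    left : ∀ i k → B i ∙ (λ j → s j k) ≡ δ i k
    left i k = begin
      Bs i                                          ≡⟨ solve 2 (λ a b → a := (con 1ℚ :* a :+ (:- con 1ℚ) :* b) :+ b) refl
                                                         (Bs i) (δ i k) ⟩
      (1ℚ * Bs i + - 1ℚ * δ i k) + δ i k            ≡⟨ cong (_+ δ i k)
        (monotone⇒injective (λ j → 1ℚ * Bs j + - 1ℚ * δ j k) vanishes i) ⟩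
      0ℚ + δ i k                                    ≡⟨ ℚ.+-identityˡ _ ⟩
      δ i k                                         ∎
      where
      Bs : Vector ℚ n
      Bs j = B j ∙ (λ l → s l k)
      sBs : ∀ i → s i ∙ Bs ≡ s i k
      sBs i = begin
        s i ∙ Bs                                          ≡⟨ ∙-assoc (s i) B (λ l → s l k) ⟩
        (λ l → s i ∙ (λ j → B j l)) ∙ (λ l → s l k)       ≡⟨ sum-cong-≗ (λ l → cong (_* s l k) (right i l)) ⟩
        δ i ∙ (λ l → s l k)                               ≡⟨ δ-∙ i (λ l → s l k) ⟩
        s i k                                             ∎
      sδ : ∀ i → s i ∙ (λ j → δ j k) ≡ s i k
      sδ i = trans (sum-cong-≗ (λ j → trans (cong (s i j *_) (δ-sym j k)) (ℚ.*-comm (s i j) (δ k j)))) (δ-∙ k (s i))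
      vanishes : ∀ i → s i ∙ (λ j → 1ℚ * Bs j + - 1ℚ * δ j k) ≡ 0ℚ
      vanishes i = begin
        s i ∙ (λ j → 1ℚ * Bs j + - 1ℚ * δ j k)             ≡⟨ ∙-combineʳ (s i) 1ℚ Bs (- 1ℚ) (λ j → δ j k) ⟩
        1ℚ * (s i ∙ Bs) + - 1ℚ * (s i ∙ (λ j → δ j k))     ≡⟨ cong₂ (λ a b → 1ℚ * a + - 1ℚ * b) (sBs i) (sδ i) ⟩
        1ℚ * s i k + - 1ℚ * s i k                          ≡⟨ solve 1 (λ a → con 1ℚ :* a :+ (:- con 1ℚ) :* a := con 0ℚ)
                                                                refl (s i k) ⟩
        0ℚ                                                 ∎

-- Natural multiples and common denominators

·-mono-≤ : ∀ {m n} → m ℕ.≤ n → m · 1ℚ ℚ.≤ n · 1ℚ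
·-mono-≤ {n = zero}  z≤n       = ℚ.≤-refl
·-mono-≤ {n = suc n} z≤n       = ℚ.+-mono-≤ (ℚ.<⇒≤ 0<1) (·-mono-≤ {n = n} z≤n)
·-mono-≤             (s≤s m≤n) = ℚ.+-monoʳ-≤ 1ℚ (·-mono-≤ m≤n)

·-mono-< : ∀ {m n} → m ℕ.< n → m · 1ℚ ℚ.< n · 1ℚ
·-mono-< {m} m<n = ℚ.<-≤-trans
  (subst (ℚ._< 1ℚ + m · 1ℚ) (ℚ.+-identityˡ _) (ℚ.+-monoˡ-< (m · 1ℚ) 0<1))
  (·-mono-≤ m<n)

-- Unnormalised fractions keep the denominator of `q` fixed, which reduces the induction step to an
-- identity of integer polynomials.
toℚᵘ-· : ∀ m q → toℚᵘ (m · q) ℚᵘ.≃ mkℚᵘ (ℤ.+ m ℤ.* ℚ.↥ q) (ℚ.denominator-1 q)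
toℚᵘ-· zero    q                 = *≡* refl
toℚᵘ-· (suc m) q@(mkℚ _ _ _) = begin
  toℚᵘ (q + m · q)               ≈⟨ ℚ.toℚᵘ-homo-+ q (m · q) ⟩
  toℚᵘ q ℚᵘ.+ toℚᵘ (m · q)       ≈⟨ ℚᵘ.+-congʳ (toℚᵘ q) (toℚᵘ-· m q) ⟩
  toℚᵘ q ℚᵘ.+ mkℚᵘ (ℤ.+ m ℤ.* ℚ.↥ q) (ℚ.denominator-1 q)
    ≈⟨ *≡* (ring (ℚ.↥ q) (ℚ.↧ q) (ℤ.+ m)) ⟩
  mkℚᵘ (ℤ.+ suc m ℤ.* ℚ.↥ q) (ℚ.denominator-1 q) ∎
  where
  open ℚᵘ.≃-Reasoning
  ring : ∀ a d m → (a ℤ.* d ℤ.+ (m ℤ.* a) ℤ.* d) ℤ.* d ≡ ((ℤ.+ 1 ℤ.+ m) ℤ.* a) ℤ.* (d ℤ.* d)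
  ring = ℤ-Solver.solve-∀

positiveNumerator : ∀ {q} → 0ℚ ℚ.< q → ∃[ m ] ∃[ k ] 0 ℕ.< m × 0 ℕ.< k × m · q ≡ k · 1ℚ
positiveNumerator {q@(mkℚ (ℤ.+ zero)  _ _)} 0<q = contradiction (ℚ.positive {q} 0<q) λ ()
positiveNumerator {q@(mkℚ (ℤ.-[1+ _ ]) _ _)} 0<q = contradiction (ℚ.positive {q} 0<q) λ ()
positiveNumerator {q@(mkℚ (ℤ.+ suc k) d _)} 0<q = suc d , suc k , s≤s z≤n , s≤s z≤n , ℚ.toℚᵘ-injective (begin
  toℚᵘ (suc d · q)                          ≈⟨ toℚᵘ-· (suc d) q ⟩
  mkℚᵘ (ℤ.+ suc d ℤ.* ℤ.+ suc k) d          ≈⟨ *≡* (ring (ℤ.+ suc d) (ℤ.+ suc k)) ⟩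
  mkℚᵘ (ℤ.+ suc k ℤ.* ℤ.+ 1) 0              ≈⟨ toℚᵘ-· (suc k) 1ℚ ⟨
  toℚᵘ (suc k · 1ℚ)                         ∎)
  where
  open ℚᵘ.≃-Reasoning
  ring : ∀ d k → (d ℤ.* k) ℤ.* ℤ.+ 1 ≡ (k ℤ.* ℤ.+ 1) ℤ.* d
  ring = ℤ-Solver.solve-∀

commonDenominator : ∀ {n} (w : Vector ℚ n) → (∀ i → 0ℚ ℚ.< w i) →
  Σ[ c ∈ ℕ ] Σ[ k ∈ Vector ℕ n ] 0 ℕ.< c × (∀ i → 0 ℕ.< k i) × (∀ i → c · w i ≡ k i · 1ℚ)
commonDenominator {zero}  w 0<w = 1 , (λ ()) , s≤s z≤n , (λ ()) , λ ()
commonDenominator {suc n} w 0<w with commonDenominator (w ∘ suc) (0<w ∘ suc) | positiveNumerator (0<w zero)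
... | c , k , 0<c , 0<k , cw≡k | m , l , 0<m , 0<l , mw≡l =
  c ℕ.* m , (c ℕ.* l) ◂ (λ i → m ℕ.* k i) , ℕ.*-mono-≤ 0<c 0<m ,
  (λ { zero → ℕ.*-mono-≤ 0<c 0<l ; (suc i) → ℕ.*-mono-≤ 0<m (0<k i) }) , λ where
    zero    → begin
      (c ℕ.* m) · w zero   ≡⟨ ×-assocˡ (w zero) c m ⟨
      c · (m · w zero)     ≡⟨ cong (c ·_) mw≡l ⟩
      c · (l · 1ℚ)         ≡⟨ ×-assocˡ 1ℚ c l ⟩
      (c ℕ.* l) · 1ℚ       ∎
    (suc i) → begin
      (c ℕ.* m) · w (suc i)   ≡⟨ cong (_· w (suc i)) (ℕ.*-comm c m) ⟩
      (m ℕ.* c) · w (suc i)   ≡⟨ ×-assocˡ (w (suc i)) m c ⟨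
      m · (c · w (suc i))     ≡⟨ cong (m ·_) (cw≡k i) ⟩
      m · (k i · 1ℚ)          ≡⟨ ×-assocˡ 1ℚ m (k i) ⟩
      (m ℕ.* k i) · 1ℚ        ∎
  where open ≡-Reasoning

∑-lookup-++ : ∀ {A : Set} (g : A → ℚ) xs ys →
              ∑ (g ∘ lookup (xs ++ ys)) ≡ ∑ (g ∘ lookup xs) + ∑ (g ∘ lookup ys)
∑-lookup-++ g []       ys = sym (ℚ.+-identityˡ _)
∑-lookup-++ g (x ∷ xs) ys = trans (cong (g x +_) (∑-lookup-++ g xs ys)) (sym (ℚ.+-assoc (g x) _ _))

∑-lookup-replicate : ∀ {A : Set} (g : A → ℚ) m x → ∑ (g ∘ lookup (replicate m x)) ≡ m · g x
∑-lookup-replicate g zero    x = refl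
∑-lookup-replicate g (suc m) x = cong (g x +_) (∑-lookup-replicate g m x)

-- Turns a row sum over the copies in a blow-up into a sum weighted by multiplicities. The general
-- `h` is what lets the induction pass to the tail of the tabulated list.
∑-lookup-multiset : ∀ {A : Set} (g : A → ℚ) (k : A → ℕ) {n} (h : Fin n → A) →
  ∑ (g ∘ lookup (concatMap (λ x → replicate (k x) x) (tabulate h))) ≡ ∑ (λ i → k (h i) · g (h i))
∑-lookup-multiset g k {zero}  h = refl
∑-lookup-multiset g k {suc n} h = trans
  (∑-lookup-++ g (replicate (k (h zero)) (h zero)) _)
  (cong₂ _+_ (∑-lookup-replicate g (k (h zero)) (h zero)) (∑-lookup-multiset g k (h ∘ suc)))

-- Second-neighborhood matrices

Arc TwoStep : ∀ D → V D → V D → Set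
Arc D u v     = T (arc D u v)
TwoStep D u v = ¬ Arc D u v × (∃[ k ] Arc D u k × Arc D k v)

twoStep? : ∀ D u v → Dec (TwoStep D u v)
twoStep? D u v = ¬? (T? (arc D u v)) ×-dec Fin.any? (λ k → T? (arc D u k) ×-dec T? (arc D k v))

arc⇒≢ : ∀ D {u v} → Arc D u v → u ≢ v
arc⇒≢ D {u} uv refl = noLoop D u uv

d≡1⇒arc : ∀ D {u v} → d⟨_,_⟩≡_ D u v 1 → Arc D u v
d≡1⇒arc D ((a Digraph.∷ Digraph.[] , _) , _) = a

arc⇒d≡1 : ∀ D {u v} → Arc D u v → d⟨_,_⟩≡_ D u v 1
arc⇒d≡1 D {u} a = (a Digraph.∷ Digraph.[] , (arc⇒≢ D a ∷ []) ∷ [] ∷ []) , λ where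
  (s≤s z≤n) (Digraph.[] , _) → noLoop D u a

d≡2⇒twoStep : ∀ D {u v} → d⟨_,_⟩≡_ D u v 2 → TwoStep D u v
d≡2⇒twoStep D ((a Digraph.∷ (b Digraph.∷ Digraph.[]) , (_ ∷ u≢v ∷ []) ∷ _) , shortest) =
  (λ uv → shortest (s≤s (s≤s z≤n)) (uv Digraph.∷ Digraph.[] , (arc⇒≢ D uv ∷ []) ∷ [] ∷ [])) , _ , a , b

twoStep⇒d≡2 : ∀ D {u v} → TwoStep D u v → d⟨_,_⟩≡_ D u v 2
twoStep⇒d≡2 D {u} {v} (¬uv , k , uk , kv) =
  (uk Digraph.∷ (kv Digraph.∷ Digraph.[]) , (arc⇒≢ D uk ∷ u≢v ∷ []) ∷ (arc⇒≢ D kv ∷ []) ∷ [] ∷ []) , λ where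
    (s≤s z≤n)       (Digraph.[] , _)               → u≢v refl
    (s≤s (s≤s z≤n)) (a Digraph.∷ Digraph.[] , _)   → ¬uv a
  where
  -- If `v` were `u`, the two arcs through `k` would be opposite.
  u≢v : u ≢ v
  u≢v refl = simple D u k uk kv

-- Rational counterpart of `S D`: every term of the constant sequence `S D u v` equals this entry.
s : ∀ D → Square (order D)
s D u v = if does (d⟨_,_⟩≟_ D u v 1) then 1ℚ
          else if does (d⟨_,_⟩≟_ D u v 2) then - 1ℚ
          else 0ℚ

s-arc : ∀ D {u v} → Arc D u v → s D u v ≡ 1ℚ
s-arc D {u} {v} a rewrite dec-true (d⟨_,_⟩≟_ D u v 1) (arc⇒d≡1 D a) = refl

s-twoStep : ∀ D {u v} → TwoStep D u v → s D u v ≡ - 1ℚ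
s-twoStep D {u} {v} t
  rewrite dec-false (d⟨_,_⟩≟_ D u v 1) (proj₁ t ∘ d≡1⇒arc D)
        | dec-true (d⟨_,_⟩≟_ D u v 2) (twoStep⇒d≡2 D t) = refl

s-far : ∀ D {u v} → ¬ Arc D u v → ¬ TwoStep D u v → s D u v ≡ 0ℚ
s-far D {u} {v} ¬a ¬t
  rewrite dec-false (d⟨_,_⟩≟_ D u v 1) (¬a ∘ d≡1⇒arc D)
        | dec-false (d⟨_,_⟩≟_ D u v 2) (¬t ∘ d≡2⇒twoStep D) = refl

-- Arcs carried forward preserve the entry 1, and two-step pairs carried backward mean that an entry
-- -1 on the right comes from an entry -1 on the left. In all other cases 0 separates the two
-- entries.
s-mono : ∀ D D′ {u v u′ v′} → (Arc D u v → Arc D′ u′ v′) → (TwoStep D′ u′ v′ → TwoStep D u v) →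
         s D u v ℚ.≤ s D′ u′ v′
s-mono D D′ {u} {v} {u′} {v′} arcs twoSteps with twoStep? D′ u′ v′ | T? (arc D u v) | T? (arc D′ u′ v′)
... | yes t′ | _      | _     = ℚ.≤-reflexive (trans (s-twoStep D (twoSteps t′)) (sym (s-twoStep D′ t′)))
... | no _   | yes a  | _     = ℚ.≤-reflexive (trans (s-arc D a) (sym (s-arc D′ (arcs a))))
... | no ¬t′ | no ¬a  | dec′  = ℚ.≤-trans s≤0 (0≤s′ dec′)
  where
  0≤s′ : Dec (Arc D′ u′ v′) → 0ℚ ℚ.≤ s D′ u′ v′
  0≤s′ (yes a′) = subst (0ℚ ℚ.≤_) (sym (s-arc D′ a′)) (ℚ.<⇒≤ 0<1)
  0≤s′ (no ¬a′) = ℚ.≤-reflexive (sym (s-far D′ ¬a′ ¬t′))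
  s≤0 : s D u v ℚ.≤ 0ℚ
  s≤0 with twoStep? D u v
  ... | yes t = subst (ℚ._≤ 0ℚ) (sym (s-twoStep D t)) (ℚ.neg-antimono-≤ (ℚ.<⇒≤ 0<1))
  ... | no ¬t = ℚ.≤-reflexive (s-far D ¬a ¬t)

-- Serves two opposite purposes: a surjective `f` gives a blow-up, in which copies of one vertex are
-- not adjacent, and `punchIn i` gives the deletion of the vertex `i`.
pullback : ∀ D {m} → ℕ.NonZero m → (Fin m → V D) → Digraph
pullback D m≢0 f = record
  { nonEmpty = m≢0
  ; arc      = λ u v → arc D (f u) (f v)
  ; noLoop   = λ u → noLoop D (f u)
  ; simple   = λ u v → simple D (f u) (f v)
  }

s-pullback-≤ : ∀ D {m} (m≢0 : ℕ.NonZero m) (f : Fin m → V D) u v →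
               s D (f u) (f v) ℚ.≤ s (pullback D m≢0 f) u v
s-pullback-≤ D m≢0 f u v = s-mono D (pullback D m≢0 f) id
  (λ (¬uv , k , uk , kv) → ¬uv , f k , uk , kv)

-- Surjectivity lifts the middle vertex of every two-step path, so no entry -1 is lost.
s-pullback : ∀ D {m} (m≢0 : ℕ.NonZero m) (f : Fin m → V D) → (∀ x → ∃[ u ] f u ≡ x) → ∀ u v →
             s (pullback D m≢0 f) u v ≡ s D (f u) (f v)
s-pullback D m≢0 f surj u v = ℚ.≤-antisym
  (s-mono (pullback D m≢0 f) D id λ where
    (¬uv , x , ux , xv) → case surj x of λ where (k , refl) → ¬uv , k , ux , xv)
  (s-pullback-≤ D m≢0 f u v)

reverse : Digraph → Digraph
reverse D = record
  { nonEmpty = nonEmpty D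
  ; arc      = flip (arc D)
  ; noLoop   = noLoop D
  ; simple   = flip (simple D)
  }

s-reverse : ∀ D u v → s (reverse D) u v ≡ s D v u
s-reverse D u v = ℚ.≤-antisym
  (s-mono (reverse D) D id (λ (¬vu , k , vk , ku) → ¬vu , k , ku , vk))
  (s-mono D (reverse D) id (λ (¬vu , k , uk , kv) → ¬vu , k , kv , uk))

∑-filter-difference : ∀ {A : Set} {P Q : A → Set} (P? : ∀ x → Dec (P x)) (Q? : ∀ x → Dec (Q x)) →
  (∀ {x} → P x → ¬ Q x) → ∀ {n} (g : Fin n → A) →
  ∑ (λ j → if does (P? (g j)) then 1ℚ else if does (Q? (g j)) then - 1ℚ else 0ℚ)
  ≡ length (filter P? (tabulate g)) · 1ℚ - length (filter Q? (tabulate g)) · 1ℚ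
∑-filter-difference P? Q? disjoint {zero}  g = refl
∑-filter-difference P? Q? disjoint {suc n} g
  with P? (g zero) | Q? (g zero) | ∑-filter-difference P? Q? disjoint (g ∘ suc)
... | yes p | yes q | _  = contradiction q (disjoint p)
... | yes p | no _  | ih = trans (cong (1ℚ +_) ih) (solve 2 (λ a b → con 1ℚ :+ (a :- b) := (con 1ℚ :+ a) :- b) refl
    (length (filter P? (tabulate (g ∘ suc))) · 1ℚ) (length (filter Q? (tabulate (g ∘ suc))) · 1ℚ))
... | no _  | yes q | ih = trans (cong (- 1ℚ +_) ih)
  (solve 2 (λ a b → (:- con 1ℚ) :+ (a :- b) := a :- (con 1ℚ :+ b)) refl
    (length (filter P? (tabulate (g ∘ suc))) · 1ℚ) (length (filter Q? (tabulate (g ∘ suc))) · 1ℚ))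
... | no _  | no _  | ih = trans (ℚ.+-identityˡ _) ih

∑-s : ∀ D u → ∑ (s D u) ≡ d⁺ D u · 1ℚ - d⁺⁺ D u · 1ℚ
∑-s D u = ∑-filter-difference (λ v → d⟨_,_⟩≟_ D u v 1) (λ v → d⟨_,_⟩≟_ D u v 2)
  (λ d≡1 d≡2 → proj₁ (d≡2⇒twoStep D d≡2) (d≡1⇒arc D d≡1)) id

d⁺≤d⁺⁺⇒∑s≤0 : ∀ D u → d⁺ D u ℕ.≤ d⁺⁺ D u → ∑ (s D u) ℚ.≤ 0ℚ
d⁺≤d⁺⁺⇒∑s≤0 D u ≤ = subst₂ ℚ._≤_ (sym (∑-s D u)) (ℚ.+-inverseʳ (d⁺⁺ D u · 1ℚ))
  (ℚ.+-monoˡ-≤ (- (d⁺⁺ D u · 1ℚ)) (·-mono-≤ ≤))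

d⁺⁺<d⁺⇒0<∑s : ∀ D u → d⁺⁺ D u ℕ.< d⁺ D u → 0ℚ ℚ.< ∑ (s D u)
d⁺⁺<d⁺⇒0<∑s D u < = subst₂ ℚ._<_ (ℚ.+-inverseʳ (d⁺⁺ D u · 1ℚ)) (sym (∑-s D u))
  (ℚ.+-monoˡ-< (- (d⁺⁺ D u · 1ℚ)) (·-mono-< <))

-- Blow-ups and minimal counterexamples

∈-replicate : ∀ {A : Set} {x : A} {m} → 0 ℕ.< m → x ∈ replicate m x
∈-replicate (s≤s _) = here refl

module _ D (w : Vector ℚ (order D)) (0<w : ∀ j → 0ℚ ℚ.< w j) (0<sw : ∀ i → 0ℚ ℚ.< s D i ∙ w) where

  -- Replace each vertex x by k x independent copies, where k is a multiple of w.
  positiveImage⇒blowUp : ∃[ D′ ] (∀ u → 0ℚ ℚ.< ∑ (s D′ u))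
  positiveImage⇒blowUp with c , k , 0<c , 0<k , cw≡k ← commonDenominator w 0<w =
    pullback D nonZero f , λ u → subst (0ℚ ℚ.<_) (sym (rowSum u)) (pos*pos (·-mono-< 0<c) (0<sw (f u)))
    where
    open ≡-Reasoning
    copies : List (V D)
    copies = concatMap (λ x → replicate (k x) x) (allFin (order D))
    f : Fin (length copies) → V D
    f = lookup copies
    surj : ∀ x → ∃[ u ] f u ≡ x
    surj x = Any.index x∈ , sym (Any.lookup-index x∈)
      where
      x∈ : x ∈ copies
      x∈ = ∈-concatMap⁺ (λ x → replicate (k x) x) (lose (∈-allFin x) (∈-replicate (0<k x)))
    nonZero : ℕ.NonZero (length copies)
    nonZero = Fin.nonZeroIndex (proj₁ (surj (fromℕ< (ℕ.>-nonZero⁻¹ (order D) {{nonEmpty D}}))))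
    rowSum : ∀ u → ∑ (s (pullback D nonZero f) u) ≡ c · 1ℚ * (s D (f u) ∙ w)
    rowSum u = begin
      ∑ (s (pullback D nonZero f) u)              ≡⟨ sum-cong-≗ (s-pullback D nonZero f surj u) ⟩
      ∑ (s D (f u) ∘ f)                           ≡⟨ ∑-lookup-multiset (s D (f u)) k id ⟩
      ∑ (λ x → k x · s D (f u) x)                 ≡⟨ sum-cong-≗ (λ x → term (s D (f u) x) x) ⟩
      ∑ (λ x → c · 1ℚ * (s D (f u) x * w x))      ≡⟨ *-distribˡ-sum (c · 1ℚ) (λ x → s D (f u) x * w x) ⟨
      c · 1ℚ * (s D (f u) ∙ w)                    ∎
      where
      term : ∀ q x → k x · q ≡ c · 1ℚ * (q * w x)
      term q x = begin
        k x · q                  ≡⟨ cong (k x ·_) (ℚ.*-identityˡ q) ⟨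
        k x · (1ℚ * q)           ≡⟨ ×-assoc-* (k x) 1ℚ q ⟨
        k x · 1ℚ * q             ≡⟨ cong (_* q) (cw≡k x) ⟨
        c · w x * q              ≡⟨ cong (λ p → c · p * q) (ℚ.*-identityˡ (w x)) ⟨
        c · (1ℚ * w x) * q       ≡⟨ cong (_* q) (×-assoc-* c 1ℚ (w x)) ⟨
        c · 1ℚ * w x * q         ≡⟨ solve 3 (λ c w q → c :* w :* q := c :* (q :* w)) refl (c · 1ℚ) (w x) q ⟩
        c · 1ℚ * (q * w x)       ∎

  -- If s v ≤ 0 although v has a positive entry, let i maximise v i / w i; then
  -- v i * w - w i * v is a weight vector with positive image that vanishes at i,
  -- so i can be deleted.
  minimal⇒monotone : ∀ {m} → order D ≡ suc m →
    (∀ D′ → order D′ ≡ m → ∀ u → (∀ j → 0ℚ ℚ.≤ u j) → ¬ (∀ i → 0ℚ ℚ.< s D′ i ∙ u)) →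
    Monotone (s D)
  minimal⇒monotone {m} refl minimal v sv≤0 j = ℚ.≮⇒≥ impossible
    where
    r : Vector ℚ (order D)
    r k = proj₁ (reciprocal (0<w k))
    ratio : Vector ℚ (order D)
    ratio k = r k * v k
    i : V D
    i = argmax ratio j (allFin (order D))
    ratio≤ : ∀ k → ratio k ℚ.≤ ratio i
    ratio≤ k = All.lookup (f[xs]≤f[argmax] {f = ratio} j (allFin (order D))) (∈-allFin k)
    ratio*w : ∀ k → ratio k * w k ≡ v k
    ratio*w k = begin
      r k * v k * w k     ≡⟨ solve 3 (λ r v w → r :* v :* w := (r :* w) :* v) refl (r k) (v k) (w k) ⟩
      r k * w k * v k     ≡⟨ cong (_* v k) (proj₂ (proj₂ (reciprocal (0<w k)))) ⟩
      1ℚ * v k            ≡⟨ ℚ.*-identityˡ (v k) ⟩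
      v k                 ∎
      where open ≡-Reasoning
    u : Vector ℚ (order D)
    u k = v i * w k + - w i * v k
    0≤u : ∀ k → 0ℚ ℚ.≤ u k
    -- `u k` equals `(ratio i - ratio k) * (w i * w k)`, and `i` maximises the ratio.
    0≤u k = subst (0ℚ ℚ.≤_) eq (nonNeg*nonNeg
      (subst (ℚ._≤ ratio i - ratio k) (ℚ.+-inverseʳ (ratio k)) (ℚ.+-monoˡ-≤ (- ratio k) (ratio≤ k)))
      (ℚ.<⇒≤ (pos*pos (0<w i) (0<w k))))
      where
      open ≡-Reasoning
      eq : (ratio i - ratio k) * (w i * w k) ≡ u k
      eq = begin
        (ratio i - ratio k) * (w i * w k)
          ≡⟨ solve 4 (λ a b x y → (a :- b) :* (x :* y) := (a :* x) :* y :+ (:- x) :* (b :* y)) refl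
               (ratio i) (ratio k) (w i) (w k) ⟩
        ratio i * w i * w k + - w i * (ratio k * w k)
          ≡⟨ cong₂ (λ a b → a * w k + - w i * b) (ratio*w i) (ratio*w k) ⟩
        u k ∎
    ui≡0 : u i ≡ 0ℚ
    ui≡0 = solve 2 (λ v w → v :* w :+ (:- w) :* v := con 0ℚ) refl (v i) (w i)
    impossible : ¬ 0ℚ ℚ.< v j
    impossible 0<vj = remaining (m ℕ.≟ 0)
      where
      0<vi : 0ℚ ℚ.< v i
      0<vi = subst (0ℚ ℚ.<_) (ratio*w i) (pos*pos
        (ℚ.<-≤-trans (pos*pos (proj₁ (proj₂ (reciprocal (0<w j)))) 0<vj) (ratio≤ j)) (0<w i))
      -- The image is `v i` times the positive image of `w`, plus `w i` times the nonnegative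
      -- `- (s D k ∙ v)`.
      0<su : ∀ k → 0ℚ ℚ.< s D k ∙ u
      0<su k = subst (0ℚ ℚ.<_)
        (trans (solve 4 (λ a x b y → a :* x :+ b :* (:- y) := a :* x :+ (:- b) :* y) refl
                 (v i) (s D k ∙ w) (w i) (s D k ∙ v))
               (sym (∙-combineʳ (s D k) (v i) w (- w i) v)))
        (pos+nonNeg (pos*pos 0<vi (0<sw k)) (nonNeg*nonNeg (ℚ.<⇒≤ (0<w i)) (nonPos⇒0≤- (sv≤0 k))))
      withoutI : ∀ k → ∑ (removeAt (λ l → s D k l * u l) i) ≡ s D k ∙ u
      withoutI k = sym (begin
        s D k ∙ u                                           ≡⟨ sum-remove {i = i} (λ l → s D k l * u l) ⟩
        s D k i * u i + ∑ (removeAt (λ l → s D k l * u l) i) ≡⟨ cong (_+ ∑ (removeAt (λ l → s D k l * u l) i))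
          (trans (cong (s D k i *_) ui≡0) (ℚ.*-zeroʳ (s D k i))) ⟩
        0ℚ + ∑ (removeAt (λ l → s D k l * u l) i)           ≡⟨ ℚ.+-identityˡ _ ⟩
        ∑ (removeAt (λ l → s D k l * u l) i)                ∎)
        where open ≡-Reasoning
      remaining : ¬ Dec (m ≡ 0)
      -- A single vertex cannot be deleted, as a digraph is non-empty; but then `u` is zero and so
      -- is its image.
      remaining (yes refl) = ℚ.<-irrefl refl (subst (0ℚ ℚ.<_) (sym (withoutI i)) (0<su i))
      remaining (no m≢0) =
        minimal (pullback D (ℕ.≢-nonZero m≢0) (punchIn i)) refl (u ∘ punchIn i) (0≤u ∘ punchIn i) λ k →
          ℚ.<-≤-trans (subst (0ℚ ℚ.<_) (sym (withoutI (punchIn i k))) (0<su (punchIn i k)))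
            (∑-mono-≤ λ l → ℚ.*-monoʳ-≤-nonNeg (u (punchIn i l)) {{nonNegative (0≤u (punchIn i l))}}
              (s-pullback-≤ D (ℕ.≢-nonZero m≢0) (punchIn i) k l))

-- Adding 1 to every entry of a large multiple of `w` makes the entries positive, as needed to
-- divide by them in `minimal⇒monotone`, without spoiling the strict image.
positivePerturbation : ∀ {n} (A : Square n) w → (∀ j → 0ℚ ℚ.≤ w j) → (∀ i → 0ℚ ℚ.< A i ∙ w) →
                       ∃[ w′ ] (∀ j → 0ℚ ℚ.< w′ j) × (∀ i → 0ℚ ℚ.< A i ∙ w′)
positivePerturbation {n} A w 0≤w 0<Aw
  with M , 0<M , bound ← dominate (allFin n) (λ i → A i ∙ w) (λ i → A i ∙ const 1ℚ) =
  (λ j → M * w j + 1ℚ * 1ℚ) ,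
  (λ j → subst (0ℚ ℚ.<_) (ℚ.+-comm 1ℚ (M * w j)) (pos+nonNeg 0<1 (nonNeg*nonNeg (ℚ.<⇒≤ 0<M) (0≤w j)))) ,
  λ i → subst (0ℚ ℚ.<_)
    (trans (cong (M * (A i ∙ w) +_) (sym (ℚ.*-identityˡ (A i ∙ const 1ℚ))))
           (sym (∙-combineʳ (A i) M w 1ℚ (const 1ℚ))))
    (bound (∈-allFin i) (0<Aw i))

-- Induction on the order replaces the choice of a minimal counterexample: the claim for `m` is
-- exactly the minimality required at order `suc m`.
noInverseNonNeg⇒noPositiveImage : (∀ D → ¬ InverseNonNeg (s D)) →
  ∀ m D → order D ≡ m → ∀ w → (∀ j → 0ℚ ℚ.≤ w j) → ¬ (∀ i → 0ℚ ℚ.< s D i ∙ w)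
noInverseNonNeg⇒noPositiveImage noInv zero    D eq w _ _ = ℕ.≢-nonZero⁻¹ (order D) {{nonEmpty D}} eq
noInverseNonNeg⇒noPositiveImage noInv (suc m) D eq w 0≤w 0<sw =
  let w′ , 0<w′ , 0<sw′ = positivePerturbation (s D) w 0≤w 0<sw
  in noInv D (monotone⇒inverseNonNeg (s D)
    (minimal⇒monotone D w′ 0<w′ 0<sw′ eq (noInverseNonNeg⇒noPositiveImage noInv m)))

-- Cauchy reals

seq-sum : ∀ {k} (v : Vector ℝ k) n → seq (sum v) n ≡ ∑ (λ j → seq (v j) n)
seq-sum {zero}  v n = refl
seq-sum {suc k} v n = cong (seq (v zero) n +_) (seq-sum (v ∘ suc) n)

seq-𝐈 : ∀ {k} (i j : Fin k) n → seq (𝐈 i j) n ≡ δ i j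
seq-𝐈 i j n with does (i Fin.≟ j)
... | true  = refl
... | false = refl

seq-S : ∀ D i j n → seq (S D i j) n ≡ s D i j
seq-S D i j n with does (d⟨_,_⟩≟_ D i j 1) | does (d⟨_,_⟩≟_ D i j 2)
... | true  | _     = refl
... | false | true  = refl
... | false | false = refl

seq-S· : ∀ D v i n → seq ((S D ·ᵛ v) i) n ≡ s D i ∙ (λ j → seq (v j) n)
seq-S· D v i n = trans (seq-sum (λ j → S D i j *ᴿ v j) n)
  (sum-cong-≗ (λ j → cong (_* seq (v j) n) (seq-S D i j n)))

seq-·S : ∀ D B i k n → seq ((B ·ᴹ S D) i k) n ≡ (λ j → seq (B i j) n) ∙ (λ j → s D j k)
seq-·S D B i k n = trans (seq-sum (λ j → B i j *ᴿ S D j k) n)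
  (sum-cong-≗ (λ j → cong (seq (B i j) n *_) (seq-S D j k n)))

S·𝟏 : ∀ D i n → seq ((S D ·ᵛ 𝟏) i) n ≡ ∑ (s D i)
S·𝟏 D i n = trans (seq-S· D 𝟏 i n) (sum-cong-≗ (λ j → ℚ.*-identityʳ (s D i j)))

Eventually-× : ∀ {P Q : ℕ → Set} → Eventually P → Eventually Q → Eventually (λ n → P n × Q n)
Eventually-× (M , p) (N , q) = M ℕ.⊔ N , λ n ≤n →
  p n (ℕ.m⊔n≤o⇒m≤o M N ≤n) , q n (ℕ.m⊔n≤o⇒n≤o M N ≤n)

Eventually-∀ : ∀ {k} {P : Fin k → ℕ → Set} → (∀ i → Eventually (P i)) → Eventually (λ n → ∀ i → P i n)
Eventually-∀ {zero}  ev = 0 , λ _ _ ()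
Eventually-∀ {suc k} ev with N , p ← Eventually-× (ev zero) (Eventually-∀ (ev ∘ suc)) =
  N , λ { n N≤n zero → proj₁ (p n N≤n) ; n N≤n (suc i) → proj₂ (p n N≤n) i }

Eventually-map : ∀ {P Q : ℕ → Set} → (∀ n → P n → Q n) → Eventually P → Eventually Q
Eventually-map f (N , p) = N , λ n N≤n → f n (p n N≤n)

Eventually-witness : ∀ {P : ℕ → Set} → Eventually P → ∃ P
Eventually-witness (N , p) = N , p N ℕ.≤-refl

<+ε : ∀ {p q ε} → p ℚ.≤ q → 0ℚ ℚ.< ε → p ℚ.< q + ε
<+ε {p} {q} {ε} p≤q 0<ε = subst (ℚ._< q + ε) (ℚ.+-identityʳ p) (ℚ.+-mono-≤-< p≤q 0<ε)

pointwise-≤ : ∀ x y → (∀ n → seq x n ℚ.≤ seq y n) → x ≤ᴿ y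
pointwise-≤ x y x≤y ε 0<ε = 0 , λ n _ → <+ε (x≤y n) 0<ε

pointwise-≈ : ∀ x y → (∀ n → seq x n ≡ seq y n) → x ≈ᴿ y
pointwise-≈ x y x≡y ε 0<ε = 0 , λ n _ →
  subst (ℚ._< ε) (sym (cong ∣_∣ (trans (cong (_- seq y n) (x≡y n)) (ℚ.+-inverseʳ (seq y n))))) 0<ε

constant-≤0 : ∀ x {a} → (∀ n → seq x n ≡ a) → x ≤ᴿ 0ᴿ → a ℚ.≤ 0ℚ
constant-≤0 x {a} x≡a x≤0 = ℚ.≮⇒≥ λ 0<a →
  let n , xn<a = Eventually-witness (x≤0 a 0<a)
  in ℚ.<-irrefl (trans (x≡a n) (sym (ℚ.+-identityˡ a))) xn<a

module _ (em : ExcludedMiddle 0ℓ) where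

  dne : ∀ {P : Set} → ¬ ¬ P → P
  dne = decidable-stable em

  -- A sequence that is not eventually below `ε` has a term of at least `ε` beyond the index after
  -- which terms differ by less than `ε / 2`; all later terms then exceed `ε / 2`.
  ≰0⇒0< : ∀ x → ¬ x ≤ᴿ 0ᴿ → 0ᴿ <ᴿ x
  ≰0⇒0< x x≰0 = dne λ ¬0<x → x≰0 λ ε 0<ε → dne λ ¬small →
    let N , close = cauchy x (½ * ε) (0<½ε 0<ε)
        n , N≤n , ε≤xn = dne {∃[ n ] N ℕ.≤ n × ε ℚ.≤ seq x n} λ none →
          ¬small (N , λ n N≤n → subst (seq x n ℚ.<_) (sym (ℚ.+-identityˡ ε))
            (ℚ.≰⇒> λ ε≤xn → none (n , N≤n , ε≤xn)))
    in ¬0<x (½ * ε , 0<½ε 0<ε , N , λ m N≤m → begin-strict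
      0ℚ + ½ * ε                                ≡⟨ solve 1 (λ h → con 0ℚ :+ h := (h :+ h) :- h) refl (½ * ε) ⟩
      (½ * ε + ½ * ε) - ½ * ε                   ≡⟨ cong (_- ½ * ε) (½ε+½ε≡ε ε) ⟩
      ε - ½ * ε                                 <⟨ ℚ.+-mono-≤-< ε≤xn (ℚ.neg-antimono-< (close n m N≤n N≤m)) ⟩
      seq x n - ∣ seq x n - seq x m ∣           ≤⟨ ℚ.+-monoʳ-≤ (seq x n)
                                                     (ℚ.neg-antimono-≤ (p≤∣p∣ (seq x n - seq x m))) ⟩
      seq x n - (seq x n - seq x m)             ≡⟨ solve 2 (λ a b → a :- (a :- b) := b) refl (seq x n) (seq x m) ⟩
      seq x m                                   ∎)
    where open ℚ.≤-Reasoning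

≤∧≥0⇒≈0 : ∀ x → 0ᴿ ≤ᴿ x → x ≤ᴿ 0ᴿ → x ≈ᴿ 0ᴿ
≤∧≥0⇒≈0 x 0≤x x≤0 ε 0<ε = Eventually-map
  (λ n (0<x+ε , x<ε) → ∣∣< (seq x n) 0<x+ε (subst (seq x n ℚ.<_) (ℚ.+-identityˡ ε) x<ε))
  (Eventually-× (0≤x ε 0<ε) (x≤0 ε 0<ε))
  where
  ∣∣< : ∀ p → 0ℚ ℚ.< p + ε → p ℚ.< ε → ∣ p - 0ℚ ∣ ℚ.< ε
  ∣∣< p 0<p+ε p<ε with ℚ.∣p∣≡p∨∣p∣≡-p (p - 0ℚ)
  ... | inj₁ e = subst (ℚ._< ε) (trans (solve 1 (λ p → p := p :- con 0ℚ) refl p) (sym e)) p<ε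
  ... | inj₂ e = subst₂ ℚ._<_
    (trans (solve 1 (λ p → (:- p) :+ con 0ℚ := :- (p :- con 0ℚ)) refl p) (sym e))
    (solve 2 (λ p e → (:- p) :+ (p :+ e) := e) refl p ε)
    (ℚ.+-monoʳ-< (- p) 0<p+ε)

-- The relation `_≤ᴿ 0ᴿ` for bare sequences, so that error terms can be added without packaging them
-- as reals.
LimSup≤0 : (ℕ → ℚ) → Set
LimSup≤0 f = ∀ ε → 0ℚ ℚ.< ε → Eventually (λ n → f n ℚ.< ε)

LimSup≤0-+ : ∀ {f g} → LimSup≤0 f → LimSup≤0 g → LimSup≤0 (λ n → f n + g n)
LimSup≤0-+ f≤0 g≤0 ε 0<ε = Eventually-map
  (λ n (f< , g<) → subst (_ ℚ.<_) (½ε+½ε≡ε ε) (ℚ.+-mono-< f< g<))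
  (Eventually-× (f≤0 (½ * ε) (0<½ε 0<ε)) (g≤0 (½ * ε) (0<½ε 0<ε)))

LimSup≤0-∑ : ∀ {k} {f : Fin k → ℕ → ℚ} → (∀ j → LimSup≤0 (f j)) → LimSup≤0 (λ n → ∑ (λ j → f j n))
LimSup≤0-∑ {zero}  f≤0 ε 0<ε = 0 , λ _ _ → 0<ε
LimSup≤0-∑ {suc k} f≤0       = LimSup≤0-+ (f≤0 zero) (LimSup≤0-∑ (f≤0 ∘ suc))

-- Terms may have the wrong sign by less than `β`. A positive product then has one factor smaller
-- than `β` in absolute value and the other at most the common bound `A + B`, and `β` is chosen so
-- that their product is `ε`.
LimSup≤0-nonNeg*nonPos : ∀ x y → 0ᴿ ≤ᴿ x → y ≤ᴿ 0ᴿ → LimSup≤0 (seq (x *ᴿ y))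
LimSup≤0-nonNeg*nonPos x y 0≤x y≤0 ε 0<ε =
  let A , A>0 , ∣x∣≤A = bounded x
      B , B>0 , ∣y∣≤B = bounded y
      C>0 = ℚ.pos+pos⇒pos A {{A>0}} B {{B>0}}
      β , 0<β , Cβ≡ε = scale (A + B) C>0 ε 0<ε
  in Eventually-map
    (λ n ((∣x∣≤A , ∣y∣≤B) , (0<x+β , y<β)) → bound (seq x n) (seq y n) C>0 Cβ≡ε
      (begin
        seq x n      ≤⟨ p≤∣p∣ (seq x n) ⟩
        ∣ seq x n ∣  ≤⟨ ∣x∣≤A ⟩
        A            ≡⟨ ℚ.+-identityʳ A ⟨
        A + 0ℚ       ≤⟨ ℚ.+-monoʳ-≤ A (ℚ.<⇒≤ (ℚ.positive⁻¹ B {{B>0}})) ⟩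
        A + B        ∎)
      (begin
        - seq y n    ≤⟨ -p≤∣p∣ (seq y n) ⟩
        ∣ seq y n ∣  ≤⟨ ∣y∣≤B ⟩
        B            ≡⟨ ℚ.+-identityˡ B ⟨
        0ℚ + B       ≤⟨ ℚ.+-monoˡ-≤ B (ℚ.<⇒≤ (ℚ.positive⁻¹ A {{A>0}})) ⟩
        A + B        ∎)
      0<x+β (subst (seq y n ℚ.<_) (ℚ.+-identityˡ β) y<β))
    (Eventually-× (Eventually-× ∣x∣≤A ∣y∣≤B) (Eventually-× (0≤x β 0<β) (y≤0 β 0<β)))
  where
  open ℚ.≤-Reasoning
  bound : ∀ {C β} p q → ℚ.Positive C → C * β ≡ ε → p ℚ.≤ C → - q ℚ.≤ C → 0ℚ ℚ.< p + β → q ℚ.< β →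
          p * q ℚ.< ε
  bound {C} {β} p q C>0 Cβ≡ε p≤C -q≤C 0<p+β q<β with 0ℚ ℚ.≤? q
  ... | yes 0≤q = begin-strict
    p * q          ≤⟨ ℚ.*-monoʳ-≤-nonNeg q {{nonNegative 0≤q}} p≤C ⟩
    C * q          <⟨ ℚ.*-monoʳ-<-pos C {{C>0}} q<β ⟩
    C * β          ≡⟨ Cβ≡ε ⟩
    ε              ∎
  ... | no q≱0 = begin-strict
    p * q                ≡⟨ solve 2 (λ p q → p :* q := (:- p) :* (:- q)) refl p q ⟩
    - p * - q            <⟨ ℚ.*-monoˡ-<-pos (- q) {{positive (neg⇒0<- (ℚ.≰⇒> q≱0))}} -p<β ⟩
    β * - q              ≤⟨ ℚ.*-monoˡ-≤-nonNeg β {{nonNegative 0≤β}} -q≤C ⟩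
    β * C                ≡⟨ trans (ℚ.*-comm β C) Cβ≡ε ⟩
    ε                    ∎
    where
    -p<β : - p ℚ.< β
    -p<β = subst₂ ℚ._<_ (ℚ.+-identityʳ (- p)) (solve 2 (λ p b → (:- p) :+ (p :+ b) := b) refl p β)
      (ℚ.+-monoʳ-< (- p) 0<p+β)
    0≤β : 0ℚ ℚ.≤ β
    0≤β = ℚ.<⇒≤ (pos-cancelˡ (ℚ.positive⁻¹ C {{C>0}}) (subst (0ℚ ℚ.<_) (sym Cβ≡ε) 0<ε))

-- A null sequence times a bounded one is null; this controls the error `(I - B S) v`.
LimSup≤0-null* : ∀ x y z → x ≈ᴿ y → LimSup≤0 (λ n → (seq y n - seq x n) * seq z n)
LimSup≤0-null* x y z x≈y ε 0<ε =
  let A , A>0 , ∣z∣≤A = bounded z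
      β , 0<β , Aβ≡ε = scale A A>0 ε 0<ε
  in Eventually-map
    (λ n (∣z∣≤A , ∣x-y∣<β) → begin-strict
      (seq y n - seq x n) * seq z n           ≤⟨ p≤∣p∣ _ ⟩
      ∣ (seq y n - seq x n) * seq z n ∣       ≡⟨ ℚ.∣p*q∣≡∣p∣*∣q∣ (seq y n - seq x n) (seq z n) ⟩
      ∣ seq y n - seq x n ∣ * ∣ seq z n ∣     ≤⟨ ℚ.*-monoˡ-≤-nonNeg ∣ seq y n - seq x n ∣
                                                   {{ℚ.∣-∣-nonNeg (seq y n - seq x n)}} ∣z∣≤A ⟩
      ∣ seq y n - seq x n ∣ * A               ≡⟨ cong (_* A) (trans
        (cong ∣_∣ (solve 2 (λ a b → b :- a := :- (a :- b)) refl (seq x n) (seq y n))) (ℚ.∣-p∣≡∣p∣ (seq x n - seq y n))) ⟩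
      ∣ seq x n - seq y n ∣ * A               <⟨ ℚ.*-monoˡ-<-pos A {{A>0}} ∣x-y∣<β ⟩
      β * A                                   ≡⟨ trans (ℚ.*-comm β A) Aβ≡ε ⟩
      ε                                       ∎)
    (Eventually-× ∣z∣≤A (x≈y β 0<β))
  where open ℚ.≤-Reasoning

-- The six statements

C₁ C₂ C₃ C₄ C₅ C₆ : Set
C₁ = (D : Digraph) → Σ[ v ∈ V D ] d⁺ D v ≤ d⁺⁺ D v
C₂ = (D : Digraph) → S D ·ᵛ 𝟏 ≯ᵛ 𝟎
C₃ = (D : Digraph) (w : Vector ℝ (order D)) → IsWeight D w → S D ·ᵛ w ≯ᵛ 𝟎
C₄ = (D : Digraph) → Σ[ w ∈ Vector ℝ (order D) ] (IsWeight D w × ¬ (w ≈ᵛ 𝟎) × S D ·ᵛ w ≤ᵛ 𝟎)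
C₅ = (D : Digraph) → Σ[ v ∈ Vector ℝ (order D) ] ((∃[ i ] 0ᴿ <ᴿ v i) × S D ·ᵛ v ≤ᵛ 𝟎)
C₆ = ¬ (Σ[ D ∈ Digraph ] Σ[ B ∈ Matrix (order D) ] (B IsInverseOf S D × 𝟎ᴹ ≤ᴹ B))

C₁⇒C₂ : C₁ → C₂
C₁⇒C₂ c₁ D = let v , d⁺≤d⁺⁺ = c₁ D in
  v , pointwise-≤ ((S D ·ᵛ 𝟏) v) 0ᴿ λ n → subst (ℚ._≤ 0ℚ) (sym (S·𝟏 D v n)) (d⁺≤d⁺⁺⇒∑s≤0 D v d⁺≤d⁺⁺)

-- A real weight vector with positive image is close to a positive rational one.
C₂⇒C₃ : ExcludedMiddle 0ℓ → C₂ → C₃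
C₂⇒C₃ em c₂ D w 0≤w = dne em λ none →
  let 0<Sw : ∀ i → 0ᴿ <ᴿ (S D ·ᵛ w) i
      0<Sw i = ≰0⇒0< em ((S D ·ᵛ w) i) (λ Sw≤0 → none (i , Sw≤0))
      -- The rational weight vector is `M * w + 1`, taken at a late index `n`. `M` lets the positive
      -- margins of the image outweigh the row sums contributed by the 1, and `r = 1 / M` is the
      -- tolerance for which `w > - r` makes the entries positive. Finitely many vertices allow one
      -- `n` for all conditions.
      M , 0<M , bound = dominate (allFin (order D)) (proj₁ ∘ 0<Sw) (λ i → s D i ∙ const 1ℚ)
      r , 0<r , rM≡1 = reciprocal 0<M
      n , ε<Sw , 0<w+r = Eventually-witness (Eventually-×
        (Eventually-∀ (λ i → proj₂ (proj₂ (0<Sw i)))) (Eventually-∀ (λ j → 0≤w j r 0<r)))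
      D′ , 0<∑s = positiveImage⇒blowUp D (λ j → M * seq (w j) n + 1ℚ * 1ℚ)
        (λ j → subst (0ℚ ℚ.<_) (shift M r (seq (w j) n) rM≡1) (pos*pos 0<M (0<w+r j)))
        (λ i → subst (0ℚ ℚ.<_) (image M n i)
          (ℚ.<-trans (bound (∈-allFin i) (proj₁ (proj₂ (0<Sw i))))
            (ℚ.+-monoˡ-< (s D i ∙ const 1ℚ) (ℚ.*-monoʳ-<-pos M {{positive 0<M}}
              (subst₂ ℚ._<_ (ℚ.+-identityˡ (proj₁ (0<Sw i))) (seq-S· D w i n) (ε<Sw i))))))
      u , S1≤0 = c₂ D′
  in <⇒≱ (0<∑s u) (constant-≤0 ((S D′ ·ᵛ 𝟏) u) (S·𝟏 D′ u) S1≤0)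
  where
  open ≡-Reasoning
  shift : ∀ M r x → r * M ≡ 1ℚ → M * (x + r) ≡ M * x + 1ℚ * 1ℚ
  shift M r x rM≡1 = begin
    M * (x + r)         ≡⟨ solve 3 (λ M r x → M :* (x :+ r) := M :* x :+ r :* M) refl M r x ⟩
    M * x + r * M       ≡⟨ cong (M * x +_) rM≡1 ⟩
    M * x + 1ℚ * 1ℚ     ∎
  image : ∀ M n i → M * (s D i ∙ (λ j → seq (w j) n)) + s D i ∙ const 1ℚ
                    ≡ s D i ∙ (λ j → M * seq (w j) n + 1ℚ * 1ℚ)
  image M n i = begin
    M * (s D i ∙ (λ j → seq (w j) n)) + s D i ∙ const 1ℚ
      ≡⟨ cong (M * (s D i ∙ (λ j → seq (w j) n)) +_) (ℚ.*-identityˡ (s D i ∙ const 1ℚ)) ⟨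
    M * (s D i ∙ (λ j → seq (w j) n)) + 1ℚ * (s D i ∙ const 1ℚ)
      ≡⟨ ∙-combineʳ (s D i) M (λ j → seq (w j) n) 1ℚ (const 1ℚ) ⟨
    s D i ∙ (λ j → M * seq (w j) n + 1ℚ * 1ℚ) ∎

-- The other alternative of Ville's theorem is a weight vector with positive
-- image under the transpose of S D, which is S (reverse D).
C₃⇒C₄ : C₃ → C₄
C₃⇒C₄ c₃ D = case ville (s D) of λ where
  (inj₂ (x , 0≤x , (j , 0<xj) , sx≤0)) →
    fromℚ ∘ x ,
    (λ k → pointwise-≤ 0ᴿ (fromℚ (x k)) λ _ → 0≤x k) ,
    (λ x≈0 → let _ , ∣xj∣<xj = Eventually-witness (x≈0 j (x j) 0<xj) in
      <⇒≱ ∣xj∣<xj (subst (ℚ._≤ ∣ x j - 0ℚ ∣) (ℚ.+-identityʳ (x j)) (p≤∣p∣ (x j - 0ℚ)))) ,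
    λ i → pointwise-≤ ((S D ·ᵛ (fromℚ ∘ x)) i) 0ᴿ λ n → subst (ℚ._≤ 0ℚ) (sym (seq-S· D (fromℚ ∘ x) i n)) (sx≤0 i)
  (inj₁ (y , 0≤y , 0<ys)) →
    let j , Sy≤0 = c₃ (reverse D) (fromℚ ∘ y) (λ k → pointwise-≤ 0ᴿ (fromℚ (y k)) λ _ → 0≤y k) in
    contradiction
      (subst (ℚ._≤ 0ℚ) (trans (sum-cong-≗ (λ i → cong (_* y i) (s-reverse D j i))) (∙-comm (λ i → s D i j) y))
        (constant-≤0 ((S (reverse D) ·ᵛ (fromℚ ∘ y)) j) (seq-S· (reverse D) (fromℚ ∘ y) j) Sy≤0))
      (<⇒≱ (0<ys j))

-- The same vector works: if no entry were positive, all of them would be both nonnegative and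
-- nonpositive, hence zero.
C₄⇒C₅ : ExcludedMiddle 0ℓ → C₄ → C₅
C₄⇒C₅ em c₄ D = let w , 0≤w , w≉0 , Sw≤0 = c₄ D in
  w ,
  dne em (λ none → w≉0 λ j → ≤∧≥0⇒≈0 (w j) (0≤w j) (dne em λ wj≰0 → none (j , ≰0⇒0< em (w j) wj≰0))) ,
  Sw≤0

-- v = B (S v) + (I - B S) v ≤ 0.
C₅⇒C₆ : C₅ → C₆
C₅⇒C₆ c₅ (D , B , (_ , BS≈I) , 0≤B) =
  let v , (i , ε , 0<ε , ε<vi) , Sv≤0 = c₅ D
      -- The margin `ε` by which `v i` is positive is reused as the tolerance for `v i` being at
      -- most 0, so one late term is both below and above `ε`.
      n , vi<ε , 0+ε<vi = Eventually-witness (Eventually-× (v≤0 v Sv≤0 i ε 0<ε) ε<vi)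
  in ℚ.<-asym vi<ε (subst (ℚ._< seq (v i) n) (ℚ.+-identityˡ ε) 0+ε<vi)
  where
  v≤0 : ∀ v → S D ·ᵛ v ≤ᵛ 𝟎 → ∀ i → LimSup≤0 (seq (v i))
  v≤0 v Sv≤0 i ε 0<ε = Eventually-map (λ n → subst (ℚ._< ε) (expansion n))
    (LimSup≤0-+
      (LimSup≤0-∑ λ j → LimSup≤0-nonNeg*nonPos (B i j) ((S D ·ᵛ v) j) (0≤B i j) (Sv≤0 j))
      (LimSup≤0-∑ λ k → LimSup≤0-null* ((B ·ᴹ S D) i k) (𝐈 i k) (v k) (BS≈I i k))
      ε 0<ε)
    where
    open ≡-Reasoning
    expansion : ∀ n → ∑ (λ j → seq (B i j) n * seq ((S D ·ᵛ v) j) n)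
                      + ∑ (λ k → (seq (𝐈 i k) n - seq ((B ·ᴹ S D) i k) n) * seq (v k) n)
                      ≡ seq (v i) n
    expansion n = begin
      ∑ (λ j → seq (B i j) n * seq ((S D ·ᵛ v) j) n)
        + ∑ (λ k → (seq (𝐈 i k) n - seq ((B ·ᴹ S D) i k) n) * seq (v k) n)
          ≡⟨ cong₂ _+_ (sum-cong-≗ (λ j → cong (b j *_) (seq-S· D v j n)))
                       (sum-cong-≗ (λ k → cong (_* x k) (difference k))) ⟩
      b ∙ (λ j → s D j ∙ x) + (λ k → 1ℚ * δ i k + - 1ℚ * bs k) ∙ x
          ≡⟨ cong₂ _+_ (∙-assoc b (s D) x) (∙-combineˡ 1ℚ (δ i) (- 1ℚ) bs x) ⟩
      bs ∙ x + (1ℚ * (δ i ∙ x) + - 1ℚ * (bs ∙ x))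
          ≡⟨ solve 2 (λ p q → p :+ (con 1ℚ :* q :+ (:- con 1ℚ) :* p) := q) refl (bs ∙ x) (δ i ∙ x) ⟩
      δ i ∙ x
          ≡⟨ δ-∙ i x ⟩
      x i ∎
      where
      x b bs : Vector ℚ (order D)
      x k  = seq (v k) n
      b j  = seq (B i j) n
      bs k = b ∙ (λ j → s D j k)
      difference : ∀ k → seq (𝐈 i k) n - seq ((B ·ᴹ S D) i k) n ≡ 1ℚ * δ i k + - 1ℚ * bs k
      difference k = begin
        seq (𝐈 i k) n - seq ((B ·ᴹ S D) i k) n
          ≡⟨ cong₂ _-_ (seq-𝐈 i k n) (seq-·S D B i k n) ⟩
        δ i k - bs k
          ≡⟨ solve 2 (λ p q → p :- q := con 1ℚ :* p :+ (:- con 1ℚ) :* q) refl (δ i k) (bs k) ⟩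
        1ℚ * δ i k + - 1ℚ * bs k ∎

-- If every vertex violated (1), all row sums of `s D` would be positive, so the all-ones vector
-- would be a weight vector with positive image.
C₆⇒C₁ : C₆ → C₁
C₆⇒C₁ c₆ D = case Fin.any? (λ v → d⁺ D v ℕ.≤? d⁺⁺ D v) of λ where
    (yes found) → found
    (no none)   → contradiction
      (λ i → subst (0ℚ ℚ.<_) (sum-cong-≗ (λ j → sym (ℚ.*-identityʳ (s D i j))))
        (d⁺⁺<d⁺⇒0<∑s D i (ℕ.≰⇒> λ d⁺≤d⁺⁺ → none (i , d⁺≤d⁺⁺))))
      (noInverseNonNeg⇒noPositiveImage noInverse (order D) D refl (const 1ℚ) (λ _ → ℚ.<⇒≤ 0<1))
  where
  noInverse : ∀ D → ¬ InverseNonNeg (s D)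
  noInverse D (B , right , left , 0≤B) = c₆ (D , Bᴿ , (SB≈I , BS≈I) , 0≤Bᴿ)
    where
    Bᴿ : Matrix (order D)
    Bᴿ i j = fromℚ (B i j)
    SB≈I : S D ·ᴹ Bᴿ ≈ᴹ 𝐈
    SB≈I i k = pointwise-≈ ((S D ·ᴹ Bᴿ) i k) (𝐈 i k) λ n →
      trans (seq-S· D (λ j → Bᴿ j k) i n) (trans (right i k) (sym (seq-𝐈 i k n)))
    BS≈I : Bᴿ ·ᴹ S D ≈ᴹ 𝐈
    BS≈I i k = pointwise-≈ ((Bᴿ ·ᴹ S D) i k) (𝐈 i k) λ n →
      trans (seq-·S D Bᴿ i k n) (trans (left i k) (sym (seq-𝐈 i k n)))
    0≤Bᴿ : 𝟎ᴹ ≤ᴹ Bᴿ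
    0≤Bᴿ i k = pointwise-≤ 0ᴿ (Bᴿ i k) λ _ → 0≤B i k

theorem2p6 : ExcludedMiddle 0ℓ →
    AllEquivalent
    ( ((D : Digraph) → Σ[ v ∈ V D ] d⁺ D v ≤ d⁺⁺ D v)
    ∷ ((D : Digraph) → S D ·ᵛ 𝟏 ≯ᵛ 𝟎)
    ∷ ((D : Digraph) (w : Vector ℝ (order D)) → IsWeight D w → S D ·ᵛ w ≯ᵛ 𝟎)
    ∷ ((D : Digraph) → Σ[ w ∈ Vector ℝ (order D) ] (IsWeight D w × ¬ (w ≈ᵛ 𝟎) × S D ·ᵛ w ≤ᵛ 𝟎))
    ∷ ((D : Digraph) → Σ[ v ∈ Vector ℝ (order D) ] ((∃[ i ] 0ᴿ <ᴿ v i) × S D ·ᵛ v ≤ᵛ 𝟎))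
    ∷ (¬ (Σ[ D ∈ Digraph ] Σ[ B ∈ Matrix (order D) ] (B IsInverseOf S D × 𝟎ᴹ ≤ᴹ B)))
    ∷ [] )
-- `C₁` is the hub: each statement is carried along the cycle to `C₁` and from there to any other.
theorem2p6 em i j = fromC₁ j ∘ toC₁ i
  where
  Cs = C₁ ∷ C₂ ∷ C₃ ∷ C₄ ∷ C₅ ∷ C₆ ∷ []
  C₁⇒C₃ = C₂⇒C₃ em ∘ C₁⇒C₂
  C₁⇒C₄ = C₃⇒C₄ ∘ C₁⇒C₃
  C₁⇒C₅ = C₄⇒C₅ em ∘ C₁⇒C₄
  C₅⇒C₁ = C₆⇒C₁ ∘ C₅⇒C₆
  C₄⇒C₁ = C₅⇒C₁ ∘ C₄⇒C₅ em
  C₃⇒C₁ = C₄⇒C₁ ∘ C₃⇒C₄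
  toC₁ : ∀ i → Vec.lookup Cs i → C₁
  toC₁ 0F = id
  toC₁ 1F = C₃⇒C₁ ∘ C₂⇒C₃ em
  toC₁ 2F = C₃⇒C₁
  toC₁ 3F = C₄⇒C₁
  toC₁ 4F = C₅⇒C₁
  toC₁ 5F = C₆⇒C₁
  fromC₁ : ∀ i → C₁ → Vec.lookup Cs i
  fromC₁ 0F = id
  fromC₁ 1F = C₁⇒C₂
  fromC₁ 2F = C₁⇒C₃
  fromC₁ 3F = C₁⇒C₄
  fromC₁ 4F = C₁⇒C₅
  fromC₁ 5F = C₅⇒C₆ ∘ C₁⇒C₅
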